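{- There exist a polynomial-time algorithm and a constant $c>0$ such that, given any instance $(G,k)$ of Max-Bisec-ATLB (a graph $G$ and a nonnegative integer $k$), the algorithm outputs an instance $(G',k')$ of Max-Bisec-ATLB such that: $G$ has a bisection of size at least $\lceil |E(G)|/2\rceil+k$ if and only if $G'$ has a bisection of size at least $\lceil |E(G')|/2\rceil+k'$; $k'\le k$; and $G'$ has at most $c(k^2+1)$ vertices and at most $c(k^3+1)$ edges. In other words, Max-Bisec-ATLB has a kernel with $O(k^2)$ vertices and $O(k^3)$ edges.
   Context: Graphs are finite, simple and undirected. For a graph $G=(V,E)$ with $m=|E|$ edges, a bisection $(X,Y)$ of $G$ is a partition of $V$ into sets $X$ and $Y$ with $|X|\le |Y|\le |X|+1$; its size is the number of edges with one endpoint in $X$ and the other in $Y$. The parameterized problem Max Bisection above Tight Lower Bound (Max-Bisec-ATLB) is: given a graph $G=(V,E)$ and an integer $k\ge 0$ (the parameter), decide whether $G$ has a bisection of size at least $\lceil m/2\rceil+k$. A kernel for a parameterized problem is a polynomial-time algorithm mapping an instance $(x,k)$ to an equivalent instance $(x',k')$ whose parameter $k'$ and size $|x'|$ are bounded by functions of $k$ alone. -}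

module Defs where

open import Data.Bool using (Bool; false; if_then_else_)
open import Data.Bool.Properties using (T?)
open import Data.Fin using (Fin; toℕ; fromℕ<; combine; remQuot)
open import Data.Fin.Properties using (toℕ<n; fromℕ<-toℕ; remQuot-combine) renaming (_<?_ to _<ᶠ?_)
open import Data.Fin.Subset using (Subset; _∈_; ∁; ∣_∣)
open import Data.Fin.Subset.Properties using (_∈?_)
open import Data.List using (List; length; filter; allFin; cartesianProduct)
open import Data.Nat using (ℕ; suc; _+_; _*_; _∸_; _^_; _≤_; _≥_; _≡ᵇ_)
open import Data.Nat.Logarithm using (⌈log₂_⌉)
open import Data.Nat.Properties using (_<?_)
open import Data.Product using (_×_; _,_; ∃-syntax; uncurry)
open import Data.Sum using (_⊎_)
open import Relation.Binary.PropositionalEquality using (_≡_; _≢_; refl; cong; trans)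
open import Relation.Nullary using (Dec; yes; no; contradiction)
open import Relation.Nullary.Decidable using (_×-dec_; _⊎-dec_)

record Graph : Set where
  field
    order  : ℕ
    adj    : Fin order → Fin order → Bool
    sym    : ∀ i j → adj i j ≡ adj j i
    irrefl : ∀ i → adj i i ≡ false

  Vertex : Set
  Vertex = Fin order

  -- An undirected edge {i , j} is listed once, as the pair with i < j.
  edges : List (Vertex × Vertex)
  edges = filter (λ (i , j) → (i <ᶠ? j) ×-dec T? (adj i j))
                 (cartesianProduct (allFin order) (allFin order))

  ∣V∣ : ℕ
  ∣V∣ = order

  ∣E∣ : ℕ
  ∣E∣ = length edges

open Graph public using (∣V∣; ∣E∣)

record Bisection (G : Graph) : Set where
  open Graph G
  field
    X : Subset order

  Y : Subset order
  Y = ∁ X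

  field
    ∣X∣≤∣Y∣   : ∣ X ∣ ≤ ∣ Y ∣
    ∣Y∣≤∣X∣+1 : ∣ Y ∣ ≤ ∣ X ∣ + 1

  Crosses : Vertex × Vertex → Set
  Crosses (i , j) = (i ∈ X × j ∈ Y) ⊎ (i ∈ Y × j ∈ X)

  crosses? : ∀ e → Dec (Crosses e)
  crosses? (i , j) = ((i ∈? X) ×-dec (j ∈? Y)) ⊎-dec ((i ∈? Y) ×-dec (j ∈? X))

  size : ℕ
  size = length (filter crosses? edges)

record Instance : Set where
  constructor _,,_
  field
    graph     : Graph
    parameter : ℕ

HasBisection≥ : Graph → ℕ → Set
HasBisection≥ G s = ∃[ B ] Bisection.size {G} B ≥ s

-- The model of computation is the unit-cost RAM whose only arithmetic operations
-- are addition and truncated subtraction, with structured control flow in place of jumps.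
-- A value at most doubles per time unit, so after t steps it has only
-- O(t + input length) bits; hence polynomial time on this machine coincides with
-- polynomial time on Turing machines.  (Unit-cost multiplication would break this.)

record State : Set where
  field
    reg : ℕ → ℕ
    mem : ℕ → ℕ

open State public

update : (ℕ → ℕ) → ℕ → ℕ → (ℕ → ℕ)
update f a v b = if a ≡ᵇ b then v else f b

setReg : ℕ → ℕ → State → State
setReg r v σ = record { reg = update (reg σ) r v ; mem = mem σ }

setMem : ℕ → ℕ → State → State
setMem a v σ = record { reg = reg σ ; mem = update (mem σ) a v }

infixl 6 _⊕_ _⊖_

data Expr : Set where
  const   : ℕ → Expr
  var     : ℕ → Expr
  load    : Expr → Expr
  _⊕_ _⊖_ : Expr → Expr → Expr

⟦_⟧ : Expr → State → ℕ
⟦ const c ⟧ σ = c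
⟦ var r ⟧   σ = reg σ r
⟦ load e ⟧  σ = mem σ (⟦ e ⟧ σ)
⟦ e ⊕ e′ ⟧  σ = ⟦ e ⟧ σ + ⟦ e′ ⟧ σ
⟦ e ⊖ e′ ⟧  σ = ⟦ e ⟧ σ ∸ ⟦ e′ ⟧ σ

cost : Expr → ℕ
cost (const c) = 1
cost (var r)   = 1
cost (load e)  = 1 + cost e
cost (e ⊕ e′)  = 1 + cost e + cost e′
cost (e ⊖ e′)  = 1 + cost e + cost e′

infix  5 _≔_ store_≔_
infixr 4 _⨾_

data Program : Set where
  skip     : Program
  _≔_      : ℕ → Expr → Program
  store_≔_ : Expr → Expr → Program
  _⨾_      : Program → Program → Program
  cond     : Expr → Program → Program → Program
  while    : Expr → Program → Program

infix 3 ⟨_,_⟩⇓⟨_,_⟩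

-- ⟨ P , σ ⟩⇓⟨ σ′ , t ⟩: started in σ, the program P halts in σ′ after t time units.
-- Tests succeed on nonzero values.
data ⟨_,_⟩⇓⟨_,_⟩ : Program → State → State → ℕ → Set where

  ⇓skip : ∀ {σ} →
    ⟨ skip , σ ⟩⇓⟨ σ , 1 ⟩

  ⇓assign : ∀ {σ r e} →
    ⟨ r ≔ e , σ ⟩⇓⟨ setReg r (⟦ e ⟧ σ) σ , 1 + cost e ⟩

  ⇓store : ∀ {σ e e′} →
    ⟨ store e ≔ e′ , σ ⟩⇓⟨ setMem (⟦ e ⟧ σ) (⟦ e′ ⟧ σ) σ , 1 + cost e + cost e′ ⟩

  ⇓seq : ∀ {P Q σ σ′ σ″ s t} →
    ⟨ P , σ ⟩⇓⟨ σ′ , s ⟩ →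
    ⟨ Q , σ′ ⟩⇓⟨ σ″ , t ⟩ →
    ⟨ P ⨾ Q , σ ⟩⇓⟨ σ″ , s + t ⟩

  ⇓cond-true : ∀ {e P Q σ σ′ t} →
    ⟦ e ⟧ σ ≢ 0 →
    ⟨ P , σ ⟩⇓⟨ σ′ , t ⟩ →
    ⟨ cond e P Q , σ ⟩⇓⟨ σ′ , 1 + cost e + t ⟩

  ⇓cond-false : ∀ {e P Q σ σ′ t} →
    ⟦ e ⟧ σ ≡ 0 →
    ⟨ Q , σ ⟩⇓⟨ σ′ , t ⟩ →
    ⟨ cond e P Q , σ ⟩⇓⟨ σ′ , 1 + cost e + t ⟩

  ⇓while-true : ∀ {e P σ σ′ σ″ s t} →
    ⟦ e ⟧ σ ≢ 0 →
    ⟨ P , σ ⟩⇓⟨ σ′ , s ⟩ →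
    ⟨ while e P , σ′ ⟩⇓⟨ σ″ , t ⟩ →
    ⟨ while e P , σ ⟩⇓⟨ σ″ , 1 + cost e + s + t ⟩

  ⇓while-false : ∀ {e P σ} →
    ⟦ e ⟧ σ ≡ 0 →
    ⟨ while e P , σ ⟩⇓⟨ σ , 1 + cost e ⟩

bit : Bool → ℕ
bit b = if b then 1 else 0

-- The parameter is in register 0, the number n of vertices in register 1, and the
-- adjacency matrix in row-major order at the start of memory: entry (i , j) is at
-- address toℕ (combine i j) = n * i + j.
record Represents (σ : State) (I : Instance) : Set where
  open Instance I
  open Graph graph
  field
    parameter-reg : reg σ 0 ≡ parameter
    order-reg     : reg σ 1 ≡ order
    adj-mem       : ∀ i j → mem σ (toℕ (combine i j)) ≡ bit (adj i j)

input : Instance → State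
input (G ,, k) = record { reg = registers ; mem = memory }
  where
  open Graph G

  registers : ℕ → ℕ
  registers 0             = k
  registers 1             = order
  registers (suc (suc _)) = 0

  memory : ℕ → ℕ
  memory a with a <? order * order
  ... | yes a<n² = bit (uncurry adj (remQuot order (fromℕ< a<n²)))
  ... | no  _    = 0

input-represents : ∀ I → Represents (input I) I
input-represents I@(G ,, k) = record
  { parameter-reg = refl
  ; order-reg     = refl
  ; adj-mem       = adj-mem
  }
  where
  open Graph G

  adj-mem : ∀ i j → mem (input I) (toℕ (combine i j)) ≡ bit (adj i j)
  adj-mem i j with toℕ (combine i j) <? order * order
  ... | yes p = cong (λ e → bit (uncurry adj e))
                     (trans (cong (remQuot order) (fromℕ<-toℕ (combine i j) p))
                            (remQuot-combine i j))
  ... | no ¬p = contradiction (toℕ<n (combine i j)) ¬p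

-- Bit length of an instance: adjacency matrix, and the parameter in binary.
∥_∥ : Instance → ℕ
∥ G ,, k ∥ = ∣V∣ G * ∣V∣ G + ⌈log₂ suc k ⌉

_ComputesInPolyTime_ : Program → (Instance → Instance) → Set
P ComputesInPolyTime f =
  ∃[ a ] ∃[ b ] ∀ (I : Instance) →
    ∃[ σ ] ∃[ t ]
      ⟨ P , input I ⟩⇓⟨ σ , t ⟩ × t ≤ a * suc ∥ I ∥ ^ b × Represents σ (f I)

{-# OPTIONS --safe #-}
module Submission where

-- Colour the vertices by x ∈ {−1, 0, 1} (0 = not yet coloured) and let Q(x) = Σᵢⱼ aᵢⱼ xᵢ xⱼ.
-- A balanced ±1 colouring with Q(x) ≤ −4k is a bisection of size at least ⌈m/2⌉ + k.
-- A balanced partial colouring extends, two vertices at a time and with opposite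
-- colours, without increasing Q, and Q drops by 2 when the two vertices are adjacent.
-- So 2k disjoint edges give a yes-instance; otherwise a maximal matching yields a vertex
-- cover C with at most 4k vertices.  A vertex of C with 2k neighbours and 2k non-neighbours
-- outside C again gives a yes-instance.  Otherwise all but O(k²) vertices outside C have
-- the same neighbourhood.  When a class of twins contains more than (n + 1)/2 vertices,
-- every bisection separates two of its members, and deleting two twins changes the size
-- of a bisection separating them by exactly half the number of deleted edges, so this is
-- a safe reduction.  A graph without such a class that is not a yes-instance has O(k²)
-- vertices, and O(k³) edges because C covers them.
--
-- Hence the matching and C are needed only in the proof: the program deletes twins while
-- a majority class exists, and then outputs the empty graph if the result is too large.

open import Defs
import Algebra.Properties.Semiring.Sum as SemiringSum
open import Data.Bool using (Bool; true; false; not; _∧_; _∨_; _xor_; T)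
import Data.Bool.Properties as Bool
open import Data.Bool.Properties using (T?; ¬-not; not-involutive; xor-comm)
open import Data.Fin using (Fin; zero; suc; toℕ; fromℕ<; combine; punchIn)
open import Data.Fin.Permutation using (Permutation; _⟨$⟩ʳ_; transpose)
open import Data.Fin.Properties using (any?; all?; punchInᵢ≢i; toℕ<n; toℕ-fromℕ<; toℕ-injective; toℕ-combine; combine-injective) renaming (_<?_ to _<ᶠ?_; _≟_ to _≟ᶠ_; <-cmp to <-cmpᶠ)
open import Data.Fin.Subset using (Subset; ∁; ∣_∣)
open import Data.Fin.Subset.Properties using (_∈?_)
open import Data.Integer as ℤ using (ℤ; -[1+_]; 0ℤ; 1ℤ; -1ℤ; +≤+) renaming (+_ to ⁺_; _+_ to _+ℤ_; _*_ to _*ℤ_; _-_ to _-ℤ_; _≤_ to _≤ℤ_)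
import Data.Integer.Properties as ℤ
import Data.Integer.Tactic.RingSolver as ℤSolver
open import Data.List as List using (length; filter; tabulate; allFin; cartesianProduct)
open import Data.List.Properties using (length-++; filter-++; map-tabulate)
open import Data.Nat using (ℕ; zero; suc; _+_; _*_; _∸_; _^_; _≤_; _<_; _>_; _≡ᵇ_; z≤n; s≤s; s≤s⁻¹; ⌈_/2⌉)
open import Data.Nat.Properties
open import Data.Nat.Tactic.RingSolver using (solve-∀)
open import Data.Product using (_×_; _,_; proj₁; proj₂; ∃-syntax)
open import Data.Sum using (_⊎_; inj₁; inj₂)
open import Data.Unit using (tt)
open import Data.Vec as Vec using ([]; _∷_; lookup)
open import Data.Vec.Functional using (insertAt)
open import Data.Vec.Functional.Properties using (insertAt-lookup; insertAt-punchIn)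
open import Data.Vec.Properties using (lookup∘tabulate; lookup-map)
open import Function using (_∘_; id; case_of_)
open import Function.Bundles using (_⇔_; mk⇔; Equivalence)
open import Relation.Binary.Definitions using (tri<; tri≈; tri>)
open import Relation.Binary.PropositionalEquality using (_≡_; _≢_; _≗_; refl; sym; trans; cong; cong₂; subst; subst₂; module ≡-Reasoning)
open import Relation.Nullary using (Dec; yes; no; does; ¬_; contradiction)
open import Relation.Nullary.Decidable using (_×-dec_; dec-true; dec-false)
open import Relation.Unary using (Decidable)

-- Counting and cuts

open SemiringSum +-*-semiring
  using (sum; sum-syntax; sum-cong-≗; sum-remove; ∑-distrib-+; ∑-comm; sum-permute; *-distribˡ-sum; *-distribʳ-sum)

-- Over ordered pairs a ±1 colouring has Q = 2m - 4·size, which is the origin of the target -4k.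
-- Colouring a pair p, q in the better of the two opposite ways is the derandomised form of a random
-- choice: the linear terms average to zero and only -2aₚ_q remains. In odd order the one leftover
-- vertex follows the same greedy rule, so parity costs nothing.
--
-- Constants: |C| ≤ 4k, and each vertex of C has at most 2k exceptional vertices outside C, so all
-- but 4k + 8k² vertices form one set of twins. That set has at most (n + 1)/2 vertices, hence n ≤
-- 2(4k + 8k²) + 1 ≤ 32k² + 1. Every edge meets C, hence 2m ≤ 8kn.
--
-- The program tests these two inequalities, and a violation of either one proves a yes-instance.
-- The machine only adds and subtracts, so 32 and 8 are powers of two reached by doubling, and
-- products with k are repeated additions. As k may be exponential in the input length, every loop
-- is bounded by n, never by k.

sum-mono : ∀ {n} {f g : Fin n → ℕ} → (∀ i → f i ≤ g i) → sum f ≤ sum g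
sum-mono {zero}  f≤g = z≤n
sum-mono {suc n} f≤g = +-mono-≤ (f≤g zero) (sum-mono (f≤g ∘ suc))

sum-const : ∀ n c → ∑[ i < n ] c ≡ n * c
sum-const zero    c = refl
sum-const (suc n) c = cong (c +_) (sum-const n c)

count : ∀ {n} → (Fin n → Bool) → ℕ
count p = sum (bit ∘ p)

count-cong : ∀ {n} {p q : Fin n → Bool} → p ≗ q → count p ≡ count q
count-cong p≗q = sum-cong-≗ (cong bit ∘ p≗q)

bit-mono : ∀ {a b} → (a ≡ true → b ≡ true) → bit a ≤ bit b
bit-mono {false}         _   = z≤n
bit-mono {true}  {true}  _   = s≤s z≤n
bit-mono {true}  {false} a⇒b = contradiction (a⇒b refl) λ ()

bit-injective : ∀ {a b} → bit a ≡ bit b → a ≡ b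
bit-injective {false} {false} _ = refl
bit-injective {true}  {true}  _ = refl

count-mono : ∀ {n} {p q : Fin n → Bool} → (∀ i → p i ≡ true → q i ≡ true) → count p ≤ count q
count-mono p⇒q = sum-mono λ i → bit-mono (p⇒q i)

count-not : ∀ {n} (p : Fin n → Bool) → count p + count (not ∘ p) ≡ n
count-not {zero}  p = refl
count-not {suc n} p with p zero
... | true  = cong suc (count-not (p ∘ suc))
... | false = trans (+-suc _ _) (cong suc (count-not (p ∘ suc)))

count-remove : ∀ {n} x (p : Fin (suc n) → Bool) → count p ≡ bit (p x) + count (p ∘ punchIn x)
count-remove x p = sum-remove {i = x} (bit ∘ p)

count-erase : ∀ {n} {p q : Fin n → Bool} x → p x ≡ true → q x ≡ false →
              (∀ i → i ≢ x → p i ≡ q i) → count p ≡ suc (count q)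
count-erase {suc n} {p} {q} x px qx p≗q = begin
  count p                               ≡⟨ count-remove x p ⟩
  bit (p x) + count (p ∘ punchIn x)
    ≡⟨ cong₂ (λ b c → bit b + c) px (count-cong λ i → p≗q (punchIn x i) (punchInᵢ≢i x i)) ⟩
  suc (count (q ∘ punchIn x))           ≡⟨ cong (λ b → suc (bit b + count (q ∘ punchIn x))) qx ⟨
  suc (bit (q x) + count (q ∘ punchIn x)) ≡⟨ cong suc (count-remove x q) ⟨
  suc (count q)                         ∎
  where open ≡-Reasoning

-- Trims the two sets of candidate leaves in `star` to exact sizes, as balance requires.
count-choose : ∀ {n} (p : Fin n → Bool) t → t ≤ count p →
               ∃[ q ] (∀ i → q i ≡ true → p i ≡ true) × count q ≡ t
count-choose {zero}  p zero    z≤n = (λ ()) , (λ ()) , refl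
count-choose {suc n} p zero    _   =
  (λ _ → false) , (λ _ ()) , trans (sum-const (suc n) 0) (*-zeroʳ n)
count-choose {suc n} p (suc t) t≤ with p zero in eq
... | true with count-choose (p ∘ suc) t (s≤s⁻¹ t≤)
...   | q , q⇒p , cq = q′ , q′⇒p , cong suc cq
  where
  q′ : Fin (suc n) → Bool
  q′ zero    = true
  q′ (suc i) = q i
  q′⇒p : ∀ i → q′ i ≡ true → p i ≡ true
  q′⇒p zero    _ = eq
  q′⇒p (suc i)   = q⇒p i
count-choose {suc n} p (suc t) t≤ | false with count-choose (p ∘ suc) (suc t) t≤
...   | q , q⇒p , cq = q′ , q′⇒p , cq
  where
  q′ : Fin (suc n) → Bool
  q′ zero    = false
  q′ (suc i) = q i
  q′⇒p : ∀ i → q′ i ≡ true → p i ≡ true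
  q′⇒p zero    ()
  q′⇒p (suc i)   = q⇒p i

∣∣≡count : ∀ {n} (X : Subset n) → ∣ X ∣ ≡ count (lookup X)
∣∣≡count []          = refl
∣∣≡count (true ∷ X)  = cong suc (∣∣≡count X)
∣∣≡count (false ∷ X) = ∣∣≡count X

does-∈? : ∀ {n} (i : Fin n) (X : Subset n) → does (i ∈? X) ≡ lookup X i
does-∈? zero    (true ∷ X)  = refl
does-∈? zero    (false ∷ X) = refl
does-∈? (suc i) (_ ∷ X)     = does-∈? i X

module _ {A : Set} where

  length-filter-tabulate : ∀ {n} {P : A → Set} (P? : Decidable P) (f : Fin n → A) →
    length (filter P? (tabulate f)) ≡ count (does ∘ P? ∘ f)
  length-filter-tabulate {zero}  P? f = refl
  length-filter-tabulate {suc n} P? f with does (P? (f zero))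
  ... | true  = cong suc (length-filter-tabulate P? (f ∘ suc))
  ... | false = length-filter-tabulate P? (f ∘ suc)

  filter-filter : {P Q : A → Set} (P? : Decidable P) (Q? : Decidable Q) → ∀ xs →
    filter P? (filter Q? xs) ≡ filter (λ x → Q? x ×-dec P? x) xs
  filter-filter P? Q? List.[] = refl
  filter-filter P? Q? (x List.∷ xs) with does (Q? x)
  ... | false = filter-filter P? Q? xs
  ... | true with does (P? x)
  ...   | true  = cong (x List.∷_) (filter-filter P? Q? xs)
  ...   | false = filter-filter P? Q? xs

length-filter-cartesianProduct : ∀ {A B : Set} {m n} {P : A × B → Set} (P? : Decidable P)
  (f : Fin m → A) (g : Fin n → B) →
  length (filter P? (cartesianProduct (tabulate f) (tabulate g)))
    ≡ ∑[ i < m ] count (λ j → does (P? (f i , g j)))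
length-filter-cartesianProduct {m = zero}  P? f g = refl
length-filter-cartesianProduct {m = suc m} P? f g = begin
  length (filter P? (List.map (f zero ,_) (tabulate g) List.++ rest))
    ≡⟨ cong length (filter-++ P? (List.map (f zero ,_) (tabulate g)) rest) ⟩
  length (filter P? (List.map (f zero ,_) (tabulate g)) List.++ filter P? rest)
    ≡⟨ length-++ (filter P? (List.map (f zero ,_) (tabulate g))) ⟩
  length (filter P? (List.map (f zero ,_) (tabulate g))) + length (filter P? rest)
    ≡⟨ cong₂ _+_ (trans (cong (length ∘ filter P?) (map-tabulate g (f zero ,_)))
                        (length-filter-tabulate P? (λ j → f zero , g j)))
                 (length-filter-cartesianProduct P? (f ∘ suc) g) ⟩
  _ ∎
  where
  open ≡-Reasoning
  rest = cartesianProduct (tabulate (f ∘ suc)) (tabulate g)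

-- Transposing one of two copies of the sum leaves, off the diagonal, exactly one of i < j and j < i
-- for every ordered pair.
double-count-< : ∀ {n} (f : Fin n → Fin n → Bool) → (∀ i j → f i j ≡ f j i) → (∀ i → f i i ≡ false) →
  2 * ∑[ i < n ] count (λ j → does (i <ᶠ? j) ∧ f i j) ≡ ∑[ i < n ] count (f i)
double-count-< {n} f f-sym f-irrefl = begin
  2 * S                                                 ≡⟨ cong (S +_) (+-identityʳ S) ⟩
  S + S                                                 ≡⟨ cong (S +_) (∑-comm (λ i j → bit (g i j))) ⟩
  S + ∑[ i < n ] ∑[ j < n ] bit (g j i)                 ≡⟨ ∑-distrib-+ (λ i → count (g i)) _ ⟨
  ∑[ i < n ] (count (g i) + ∑[ j < n ] bit (g j i))
    ≡⟨ sum-cong-≗ (λ i → trans (sym (∑-distrib-+ (bit ∘ g i) _)) (sum-cong-≗ (split i))) ⟩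
  ∑[ i < n ] count (f i)                                ∎
  where
  open ≡-Reasoning
  g : Fin n → Fin n → Bool
  g i j = does (i <ᶠ? j) ∧ f i j
  S = ∑[ i < n ] count (g i)
  split : ∀ i j → bit (g i j) + bit (g j i) ≡ bit (f i j)
  split i j with <-cmpᶠ i j
  ... | tri< i<j _ j≮i rewrite dec-true (i <ᶠ? j) i<j | dec-false (j <ᶠ? i) j≮i = +-identityʳ _
  ... | tri> i≮j _ j<i rewrite dec-true (j <ᶠ? i) j<i | dec-false (i <ᶠ? j) i≮j = cong bit (f-sym j i)
  ... | tri≈ i≮i refl _ rewrite dec-false (i <ᶠ? i) i≮i = sym (cong bit (f-irrefl i))

-- The sum of the degrees. Unlike the list `edges`, it does not refer to the order of the vertices,
-- so relabelling and deleting vertices become manipulations of double sums; `cutVol` has the same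
-- form for this reason.
vol : Graph → ℕ
vol G = ∑[ i < ∣V∣ G ] count (Graph.adj G i)

cut : ∀ {n} → (Fin n → Fin n → Bool) → (Fin n → Bool) → Fin n → Fin n → Bool
cut a c i j = a i j ∧ (c i xor c j)

cutVol : (G : Graph) → (Fin (∣V∣ G) → Bool) → ℕ
cutVol G c = ∑[ i < ∣V∣ G ] count (cut (Graph.adj G) c i)

does-T? : ∀ b → does (T? b) ≡ b
does-T? true  = refl
does-T? false = refl

vol≡2∣E∣ : ∀ G → 2 * ∣E∣ G ≡ vol G
vol≡2∣E∣ G = trans (cong (2 *_) eq) (double-count-< adj G.sym G.irrefl)
  where
  module G = Graph G
  open G using (order; adj)
  eq : ∣E∣ G ≡ ∑[ i < order ] count (λ j → does (i <ᶠ? j) ∧ adj i j)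
  eq = trans (length-filter-cartesianProduct {m = order} {n = order} _ id id)
             (sum-cong-≗ {order} λ i → count-cong λ j → cong (does (i <ᶠ? j) ∧_) (does-T? (adj i j)))

cut-sym : ∀ {n} {a : Fin n → Fin n → Bool} (c : Fin n → Bool) → (∀ i j → a i j ≡ a j i) →
          ∀ i j → cut a c i j ≡ cut a c j i
cut-sym c a-sym i j = cong₂ _∧_ (a-sym i j) (xor-comm (c i) (c j))

cut-irrefl : ∀ {n} {a : Fin n → Fin n → Bool} (c : Fin n → Bool) → (∀ i → a i i ≡ false) →
             ∀ i → cut a c i i ≡ false
cut-irrefl c a-irrefl i = cong (_∧ (c i xor c i)) (a-irrefl i)

size≡cutVol : ∀ {G} (B : Bisection G) → 2 * Bisection.size B ≡ cutVol G (lookup (Bisection.X B))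
size≡cutVol {G} B = trans (cong (2 *_) eq)
    (double-count-< (cut adj c) (cut-sym {a = adj} c G.sym) (cut-irrefl {a = adj} c G.irrefl))
  where
  module G = Graph G
  open G using (order; adj)
  open Bisection B
  c = lookup X
  crosses : ∀ i j → does (crosses? (i , j)) ≡ c i xor c j
  crosses i j
    rewrite does-∈? i X | does-∈? j X | does-∈? i (∁ X) | does-∈? j (∁ X)
          | lookup-map i not X | lookup-map j not X
    with lookup X i | lookup X j
  ... | true  | true  = refl
  ... | true  | false = refl
  ... | false | true  = refl
  ... | false | false = refl
  assoc : ∀ a b {b′ d d′} → b ≡ b′ → d ≡ d′ → (a ∧ b) ∧ d ≡ a ∧ (b′ ∧ d′)
  assoc true  b refl refl = refl
  assoc false b _    _    = refl
  eq : size ≡ ∑[ i < order ] count (λ j → does (i <ᶠ? j) ∧ cut adj c i j)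
  eq = trans (cong length (filter-filter crosses? _ (cartesianProduct (allFin order) (allFin order))))
      (trans (length-filter-cartesianProduct {m = order} {n = order} _ id id)
             (sum-cong-≗ {order} λ i → count-cong λ j →
                assoc (does (i <ᶠ? j)) (does (T? (adj i j))) (does-T? (adj i j)) (crosses i j)))

record Balanced {n} (c : Fin n → Bool) : Set where
  field
    lower : count c ≤ count (not ∘ c)
    upper : count (not ∘ c) ≤ count c + 1

balanced-cong : ∀ {n} {c d : Fin n → Bool} → c ≗ d → Balanced c → Balanced d
balanced-cong c≗d b = record
  { lower = subst₂ _≤_ e e′ (Balanced.lower b)
  ; upper = subst₂ (λ u v → v ≤ u + 1) e e′ (Balanced.upper b) }
  where

  e = count-cong c≗d
  e′ = count-cong (cong not ∘ c≗d)

-- A colouring form of HasBisection≥, in which every crossing edge is counted twice.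
Cuttable : Graph → ℕ → Set
Cuttable G s = ∃[ c ] Balanced c × 2 * s ≤ cutVol G c

cutVol-cong : ∀ G {c d} → c ≗ d → cutVol G c ≡ cutVol G d
cutVol-cong G c≗d = sum-cong-≗ λ i → count-cong λ j → cong (Graph.adj G i j ∧_) (cong₂ _xor_ (c≗d i) (c≗d j))

hasBisection⇒cuttable : ∀ {G s} → HasBisection≥ G s → Cuttable G s
hasBisection⇒cuttable {G} {s} (B , s≤) = lookup X , record
    { lower = subst₂ _≤_ eX eY ∣X∣≤∣Y∣ ; upper = subst₂ (λ u v → v ≤ u + 1) eX eY ∣Y∣≤∣X∣+1 }
  , ≤-trans (*-monoʳ-≤ 2 s≤) (≤-reflexive (size≡cutVol B))
  where

  open Bisection B
  eX = ∣∣≡count X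
  eY : ∣ ∁ X ∣ ≡ count (not ∘ lookup X)
  eY = trans (∣∣≡count (∁ X)) (count-cong λ i → lookup-map i not X)

cuttable⇒hasBisection : ∀ {G s} → Cuttable G s → HasBisection≥ G s
cuttable⇒hasBisection {G} {s} (c , bal , s≤) = B , *-cancelˡ-≤ 2 (≤-trans s≤ (≤-reflexive
    (trans (sym (cutVol-cong G (lookup∘tabulate c))) (sym (size≡cutVol B)))))
  where

  eX : ∣ Vec.tabulate c ∣ ≡ count c
  eX = trans (∣∣≡count (Vec.tabulate c)) (count-cong (lookup∘tabulate c))
  eY : ∣ ∁ (Vec.tabulate c) ∣ ≡ count (not ∘ c)
  eY = trans (∣∣≡count (∁ (Vec.tabulate c)))
             (count-cong λ i → trans (lookup-map i not (Vec.tabulate c)) (cong not (lookup∘tabulate c i)))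
  B : Bisection G
  B = record { X = Vec.tabulate c
             ; ∣X∣≤∣Y∣ = subst₂ _≤_ (sym eX) (sym eY) (Balanced.lower bal)
             ; ∣Y∣≤∣X∣+1 = subst₂ (λ u v → v ≤ u + 1) (sym eX) (sym eY) (Balanced.upper bal) }

Yes : Graph → ℕ → Set
Yes G k = Cuttable G (⌈ ∣E∣ G /2⌉ + k)

-- The quadratic form of a graph

open SemiringSum ℤ.+-*-semiring using ()
  renaming (sum to sumℤ; sum-cong-≗ to sumℤ-cong; ∑-distrib-+ to sumℤ-+; ∑-comm to sumℤ-comm; *-distribˡ-sum to sumℤ-*ˡ)

sum⇒sumℤ : ∀ {n} (f : Fin n → ℕ) → ⁺ sum f ≡ sumℤ (⁺_ ∘ f)
sum⇒sumℤ {zero}  f = refl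
sum⇒sumℤ {suc n} f = cong (⁺ f zero +ℤ_) (sum⇒sumℤ (f ∘ suc))

sumℤ-zero : ∀ n → sumℤ {n} (λ _ → 0ℤ) ≡ 0ℤ
sumℤ-zero zero    = refl
sumℤ-zero (suc n) = trans (ℤ.+-identityˡ _) (sumℤ-zero n)

δ : ∀ {n} → Fin n → Fin n → ℤ
δ p i = ⁺ bit (does (p ≟ᶠ i))

δ-refl : ∀ {n} (p : Fin n) → δ p p ≡ 1ℤ
δ-refl p = cong (⁺_ ∘ bit) (dec-true (p ≟ᶠ p) refl)

δ-≢ : ∀ {n} {p i : Fin n} → p ≢ i → δ p i ≡ 0ℤ
δ-≢ {p = p} {i} p≢i = cong (⁺_ ∘ bit) (dec-false (p ≟ᶠ i) p≢i)

sumℤ-δ : ∀ {n} (p : Fin n) (f : Fin n → ℤ) → sumℤ (λ i → f i *ℤ δ p i) ≡ f p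
sumℤ-δ {suc n} zero f = begin
  f zero *ℤ 1ℤ +ℤ sumℤ (λ i → f (suc i) *ℤ 0ℤ)
    ≡⟨ cong₂ _+ℤ_ (ℤ.*-identityʳ (f zero)) (trans (sumℤ-cong (λ i → ℤ.*-zeroʳ (f (suc i)))) (sumℤ-zero n)) ⟩
  f zero +ℤ 0ℤ                                    ≡⟨ ℤ.+-identityʳ _ ⟩
  f zero                                           ∎
  where open ≡-Reasoning
sumℤ-δ {suc n} (suc p) f = begin
  f zero *ℤ 0ℤ +ℤ sumℤ (λ i → f (suc i) *ℤ δ p i)  ≡⟨ cong₂ _+ℤ_ (ℤ.*-zeroʳ (f zero)) (sumℤ-δ p (f ∘ suc)) ⟩
  0ℤ +ℤ f (suc p)                                    ≡⟨ ℤ.+-identityˡ _ ⟩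
  f (suc p)                                           ∎
  where open ≡-Reasoning

sgn : Bool → ℤ
sgn true  = 1ℤ
sgn false = -1ℤ

addAt : ∀ {n} → (Fin n → ℤ) → Fin n → ℤ → Fin n → ℤ
addAt x p s i = x i +ℤ s *ℤ δ p i

addAt-here : ∀ {n} (x : Fin n → ℤ) p s → x p ≡ 0ℤ → addAt x p s p ≡ s
addAt-here x p s xp = trans (cong₂ (λ u v → u +ℤ s *ℤ v) xp (δ-refl p)) (trans (ℤ.+-identityˡ _) (ℤ.*-identityʳ s))

addAt-there : ∀ {n} (x : Fin n → ℤ) {p i} s → p ≢ i → addAt x p s i ≡ x i
addAt-there x {p} {i} s p≢i =
  trans (cong (λ v → x i +ℤ s *ℤ v) (δ-≢ p≢i)) (trans (cong (x i +ℤ_) (ℤ.*-zeroʳ s)) (ℤ.+-identityʳ (x i)))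

sum-addAt : ∀ {n} (x : Fin n → ℤ) p s → sumℤ (addAt x p s) ≡ sumℤ x +ℤ s
sum-addAt x p s = trans (sumℤ-+ x (λ i → s *ℤ δ p i)) (cong (sumℤ x +ℤ_) (sumℤ-δ p (λ _ → s)))

isZero : ℤ → Bool
isZero (⁺ 0)    = true
isZero (⁺ suc _) = false
isZero -[1+ _ ]  = false

isZero⇒≡0 : ∀ {z} → isZero z ≡ true → z ≡ 0ℤ
isZero⇒≡0 {⁺ 0} _ = refl

isZero-sgn : ∀ b → isZero (sgn b) ≡ false
isZero-sgn true  = refl
isZero-sgn false = refl

data Trit : ℤ → Set where
  nil : Trit 0ℤ
  sig : ∀ b → Trit (sgn b)

chooseSign : ∀ d → ∃[ b ] sgn b *ℤ d ≤ℤ 0ℤ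
chooseSign (⁺ d)       = false , subst (_≤ℤ 0ℤ) (sym (ℤ.-1*i≡-i (⁺ d))) (ℤ.neg-mono-≤ (+≤+ (z≤n {d})))
chooseSign -[1+ d ] = true , subst (_≤ℤ 0ℤ) (sym (ℤ.*-identityˡ -[1+ d ])) ℤ.-≤+

module Form (G : Graph) where

  private module G = Graph G
  open G using (order; adj)

  weight : Fin order → Fin order → ℤ
  weight i j = ⁺ bit (adj i j)

  weight-sym : ∀ i j → weight i j ≡ weight j i
  weight-sym i j = cong (⁺_ ∘ bit) (G.sym i j)

  -- The signed number of coloured neighbours of a vertex; up to a factor 2 it is the partial
  -- derivative of `Q`.
  pull : (Fin order → ℤ) → Fin order → ℤ
  pull x i = sumℤ λ j → weight i j *ℤ x j

  Q : (Fin order → ℤ) → ℤ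
  Q x = sumℤ λ i → x i *ℤ pull x i

  pull-cong : ∀ {x y} → x ≗ y → pull x ≗ pull y
  pull-cong x≗y i = sumℤ-cong λ j → cong (weight i j *ℤ_) (x≗y j)

  Q-cong : ∀ {x y} → x ≗ y → Q x ≡ Q y
  Q-cong x≗y = sumℤ-cong λ i → cong₂ _*ℤ_ (x≗y i) (pull-cong x≗y i)

  pull-addAt : ∀ x p s q → pull (addAt x p s) q ≡ pull x q +ℤ s *ℤ weight q p
  pull-addAt x p s q = begin
    sumℤ (λ j → weight q j *ℤ (x j +ℤ s *ℤ δ p j))
      ≡⟨ sumℤ-cong (λ j → distrib (weight q j) (x j) s (δ p j)) ⟩
    sumℤ (λ j → weight q j *ℤ x j +ℤ (s *ℤ weight q j) *ℤ δ p j)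
      ≡⟨ sumℤ-+ (λ j → weight q j *ℤ x j) _ ⟩
    pull x q +ℤ sumℤ (λ j → (s *ℤ weight q j) *ℤ δ p j)
      ≡⟨ cong (pull x q +ℤ_) (sumℤ-δ p (λ j → s *ℤ weight q j)) ⟩
    pull x q +ℤ s *ℤ weight q p ∎
    where
    open ≡-Reasoning
    distrib : ∀ a b c d → a *ℤ (b +ℤ c *ℤ d) ≡ a *ℤ b +ℤ (c *ℤ a) *ℤ d
    distrib = ℤSolver.solve-∀

  -- Symmetry merges the row and the column of `p` into the factor 2, and the term in s² vanishes
  -- because there are no loops.
  Q-addAt : ∀ x p s → Q (addAt x p s) ≡ Q x +ℤ ⁺ 2 *ℤ (s *ℤ pull x p)
  Q-addAt x p s = begin
    sumℤ (λ i → addAt x p s i *ℤ pull (addAt x p s) i)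
      ≡⟨ sumℤ-cong (λ i → trans (cong (addAt x p s i *ℤ_) (pull-addAt x p s i))
                                (expand (x i) s (δ p i) (pull x i) (weight i p))) ⟩
    sumℤ (λ i → x i *ℤ pull x i +ℤ (s *ℤ (weight i p *ℤ x i) +ℤ (s *ℤ (pull x i +ℤ s *ℤ weight i p)) *ℤ δ p i))
      ≡⟨ sumℤ-+ (λ i → x i *ℤ pull x i) _ ⟩
    Q x +ℤ sumℤ (λ i → s *ℤ (weight i p *ℤ x i) +ℤ (s *ℤ (pull x i +ℤ s *ℤ weight i p)) *ℤ δ p i)
      ≡⟨ cong (Q x +ℤ_) (sumℤ-+ (λ i → s *ℤ (weight i p *ℤ x i)) _) ⟩
    Q x +ℤ (sumℤ (λ i → s *ℤ (weight i p *ℤ x i)) +ℤ sumℤ (λ i → (s *ℤ (pull x i +ℤ s *ℤ weight i p)) *ℤ δ p i))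
      ≡⟨ cong (Q x +ℤ_) (cong₂ _+ℤ_
           (trans (sumℤ-cong (λ i → cong (λ v → s *ℤ (v *ℤ x i)) (weight-sym i p)))
                  (sym (sumℤ-*ˡ s (λ i → weight p i *ℤ x i))))
           (sumℤ-δ p (λ i → s *ℤ (pull x i +ℤ s *ℤ weight i p)))) ⟩
    Q x +ℤ (s *ℤ pull x p +ℤ s *ℤ (pull x p +ℤ s *ℤ weight p p))
      ≡⟨ cong (λ v → Q x +ℤ (s *ℤ pull x p +ℤ s *ℤ (pull x p +ℤ s *ℤ ⁺ bit v))) (G.irrefl p) ⟩
    Q x +ℤ (s *ℤ pull x p +ℤ s *ℤ (pull x p +ℤ s *ℤ 0ℤ))
      ≡⟨ collect (Q x) s (pull x p) ⟩
    Q x +ℤ ⁺ 2 *ℤ (s *ℤ pull x p) ∎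
    where
    open ≡-Reasoning
    expand : ∀ a s d b w → (a +ℤ s *ℤ d) *ℤ (b +ℤ s *ℤ w) ≡
             a *ℤ b +ℤ (s *ℤ (w *ℤ a) +ℤ (s *ℤ (b +ℤ s *ℤ w)) *ℤ d)
    expand = ℤSolver.solve-∀
    collect : ∀ q s d → q +ℤ (s *ℤ d +ℤ s *ℤ (d +ℤ s *ℤ 0ℤ)) ≡ q +ℤ ⁺ 2 *ℤ (s *ℤ d)
    collect = ℤSolver.solve-∀

  -- A balanced partial colouring: +1 and −1 are the two sides, 0 means unassigned.
  record Signing (x : Fin order → ℤ) (zeros : ℕ) : Set where
    field
      trit    : ∀ i → Trit (x i)
      sum≡0   : sumℤ x ≡ 0ℤ
      #zeros  : count (isZero ∘ x) ≡ zeros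

  trit-addAt : ∀ {x : Fin order → ℤ} p b → (∀ i → Trit (x i)) → x p ≡ 0ℤ → ∀ i → Trit (addAt x p (sgn b) i)
  trit-addAt {x} p b t xp i = case p ≟ᶠ i of λ where
    (yes refl) → subst Trit (sym (addAt-here x p (sgn b) xp)) (sig b)
    (no p≢i)   → subst Trit (sym (addAt-there x (sgn b) p≢i)) (t i)

  zeros-addAt : ∀ {x : Fin order → ℤ} {z} p b → x p ≡ 0ℤ → count (isZero ∘ x) ≡ suc z →
                count (isZero ∘ addAt x p (sgn b)) ≡ z
  zeros-addAt {x} p b xp cz = suc-injective (trans (sym (count-erase p (cong isZero xp)
    (trans (cong isZero (addAt-here x p (sgn b) xp)) (isZero-sgn b))
    λ i i≢p → cong isZero (sym (addAt-there x (sgn b) (i≢p ∘ sym))))) cz)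

  -- Colouring p and q oppositely, the better of the two ways does not increase Q.
  extendPair : ∀ {x : Fin order → ℤ} {z p q} → Signing x (2 + z) → p ≢ q → x p ≡ 0ℤ → x q ≡ 0ℤ →
               ∃[ y ] Signing y z × Q y +ℤ ⁺ 2 *ℤ weight p q ≤ℤ Q x
  extendPair {x} {z} {p} {q} σ p≢q xp xq = y , record
      { trit   = trit-addAt {x₁} q (not b) (trit-addAt {x} p b (σ .trit) xp) x₁q
      ; sum≡0  = trans (sum-addAt x₁ q (sgn (not b))) (trans (cong (_+ℤ sgn (not b)) (sum-addAt x p (sgn b)))
                   (trans (cong (λ v → v +ℤ sgn b +ℤ sgn (not b)) (σ .sum≡0)) (cancel b)))
      ; #zeros = zeros-addAt {x₁} q (not b) x₁q (zeros-addAt {x} p b xp (σ .#zeros)) }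
    , Qy≤Qx
    where
    open Signing
    -- Colouring p by s and q by -s changes `Q` by 2s·d - 2·`weight p q`: the pull at q already sees
    -- p, which gives the last term. The sign s is chosen against d.
    d = pull x p -ℤ pull x q
    b = proj₁ (chooseSign d)
    x₁ = addAt x p (sgn b)
    y = addAt x₁ q (sgn (not b))
    x₁q : x₁ q ≡ 0ℤ
    x₁q = trans (addAt-there x (sgn b) p≢q) xq
    cancel : ∀ b → 0ℤ +ℤ sgn b +ℤ sgn (not b) ≡ 0ℤ
    cancel true  = refl
    cancel false = refl
    rearrange : ∀ b Q u v w → (Q +ℤ ⁺ 2 *ℤ (sgn b *ℤ u)) +ℤ ⁺ 2 *ℤ (sgn (not b) *ℤ (v +ℤ sgn b *ℤ w)) +ℤ ⁺ 2 *ℤ w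
                ≡ Q +ℤ ⁺ 2 *ℤ (sgn b *ℤ (u -ℤ v))
    rearrange true = ring
      where
      ring : ∀ Q u v w → (Q +ℤ ⁺ 2 *ℤ (1ℤ *ℤ u)) +ℤ ⁺ 2 *ℤ (-1ℤ *ℤ (v +ℤ 1ℤ *ℤ w)) +ℤ ⁺ 2 *ℤ w ≡ Q +ℤ ⁺ 2 *ℤ (1ℤ *ℤ (u -ℤ v))
      ring = ℤSolver.solve-∀
    rearrange false = ring
      where
      ring : ∀ Q u v w → (Q +ℤ ⁺ 2 *ℤ (-1ℤ *ℤ u)) +ℤ ⁺ 2 *ℤ (1ℤ *ℤ (v +ℤ -1ℤ *ℤ w)) +ℤ ⁺ 2 *ℤ w
             ≡ Q +ℤ ⁺ 2 *ℤ (-1ℤ *ℤ (u -ℤ v))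
      ring = ℤSolver.solve-∀
    Qy≤Qx : Q y +ℤ ⁺ 2 *ℤ weight p q ≤ℤ Q x
    Qy≤Qx = begin
      Q y +ℤ ⁺ 2 *ℤ weight p q
        ≡⟨ cong₂ (λ u v → u +ℤ ⁺ 2 *ℤ v) (Q-addAt x₁ q (sgn (not b))) (weight-sym p q) ⟩
      Q x₁ +ℤ ⁺ 2 *ℤ (sgn (not b) *ℤ pull x₁ q) +ℤ ⁺ 2 *ℤ weight q p
        ≡⟨ cong₂ (λ u v → u +ℤ ⁺ 2 *ℤ (sgn (not b) *ℤ v) +ℤ ⁺ 2 *ℤ weight q p) (Q-addAt x p (sgn b))
            (pull-addAt x p (sgn b) q) ⟩
      (Q x +ℤ ⁺ 2 *ℤ (sgn b *ℤ pull x p)) +ℤ ⁺ 2 *ℤ (sgn (not b) *ℤ (pull x q +ℤ sgn b *ℤ weight q p)) +ℤ ⁺ 2 *ℤ weight q p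
        ≡⟨ rearrange b (Q x) (pull x p) (pull x q) (weight q p) ⟩
      Q x +ℤ ⁺ 2 *ℤ (sgn b *ℤ d)
        ≤⟨ ℤ.+-monoʳ-≤ (Q x) (ℤ.*-monoˡ-≤-nonNeg (⁺ 2) (proj₂ (chooseSign d))) ⟩
      Q x +ℤ ⁺ 2 *ℤ 0ℤ
        ≡⟨ ℤ.+-identityʳ (Q x) ⟩
      Q x ∎
      where open ℤ.≤-Reasoning

  zeroSigning : Signing (λ _ → 0ℤ) order
  zeroSigning = record
    { trit = λ _ → nil ; sum≡0 = sumℤ-zero order
    ; #zeros = trans (sum-const order 1) (*-identityʳ order) }

  Q-zero : Q (λ _ → 0ℤ) ≡ 0ℤ
  Q-zero = sumℤ-zero order

  toColour : ℤ → Bool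
  toColour (⁺ _)     = true
  toColour -[1+ _ ] = false

  sgn-toColour : ∀ {z} → Trit z → isZero z ≡ false → sgn (toColour z) ≡ z
  sgn-toColour (sig true)  _ = refl
  sgn-toColour (sig false) _ = refl

  -- Entrywise, the product of two signs is 1 minus twice the indicator that they differ. In terms
  -- of edges this reads 2m = Q + 4·size.
  vol≡Q+2cutVol : ∀ c → ⁺ vol G ≡ Q (sgn ∘ c) +ℤ ⁺ (2 * cutVol G c)
  vol≡Q+2cutVol c = begin
    ⁺ vol G
      ≡⟨ cast (λ i j → bit (adj i j)) ⟩
    sumℤ (λ i → sumℤ λ j → weight i j)
      ≡⟨ sumℤ-cong (λ i → trans (sumℤ-cong (λ j → term (adj i j) (c i) (c j)))
            (trans (sumℤ-+ (λ j → sgn (c i) *ℤ (weight i j *ℤ sgn (c j))) _)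
              (cong (_+ℤ sumℤ (λ j → ⁺ (2 * bit (cut adj c i j))))
                  (sym (sumℤ-*ˡ (sgn (c i)) (λ j → weight i j *ℤ sgn (c j))))))) ⟩
    sumℤ (λ i → sgn (c i) *ℤ pull (sgn ∘ c) i +ℤ sumℤ (λ j → ⁺ (2 * bit (cut adj c i j))))
      ≡⟨ sumℤ-+ (λ i → sgn (c i) *ℤ pull (sgn ∘ c) i) _ ⟩
    Q (sgn ∘ c) +ℤ sumℤ (λ i → sumℤ (λ j → ⁺ (2 * bit (cut adj c i j))))
      ≡⟨ cong (Q (sgn ∘ c) +ℤ_) (sym (trans
          (cong ⁺_ (trans (*-distribˡ-sum 2 (λ i → count (cut adj c i)))
          (sum-cong-≗ λ i → *-distribˡ-sum 2 (bit ∘ cut adj c i)))) (cast (λ i j → 2 * bit (cut adj c i j))))) ⟩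
    Q (sgn ∘ c) +ℤ ⁺ (2 * cutVol G c) ∎
    where
    open ≡-Reasoning
    cast : (f : Fin order → Fin order → ℕ) → ⁺ sum (λ i → sum (f i)) ≡ sumℤ (λ i → sumℤ (λ j → ⁺ f i j))
    cast f = trans (sum⇒sumℤ (sum ∘ f)) (sumℤ-cong λ i → sum⇒sumℤ (f i))
    term : ∀ a u v → ⁺ bit a ≡ sgn u *ℤ (⁺ bit a *ℤ sgn v) +ℤ ⁺ (2 * bit (a ∧ (u xor v)))
    term true  true  true  = refl
    term true  true  false = refl
    term true  false true  = refl
    term true  false false = refl
    term false true  true  = refl
    term false true  false = refl
    term false false true  = refl
    term false false false = refl

  -- Provides an integer size s for any colouring, so that the bound on `Q` can be divided by 4
  -- before the ceiling is taken.
  cutVol-even : ∀ c → ∃[ s ] cutVol G c ≡ 2 * s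
  cutVol-even c = ∑[ i < order ] count (λ j → does (i <ᶠ? j) ∧ cut adj c i j) ,
    sym (double-count-< (cut adj c) (cut-sym {a = adj} c G.sym) (cut-irrefl {a = adj} c G.irrefl))

  cutVol-not : ∀ c → cutVol G (not ∘ c) ≡ cutVol G c
  cutVol-not c = sum-cong-≗ {order} λ i → count-cong {order} λ j → cong (adj i j ∧_) (xor-not (c i) (c j))
    where
    xor-not : ∀ u v → not u xor not v ≡ u xor v
    xor-not true  v = refl
    xor-not false v = not-involutive v

-- Rounding up is free because s is an integer; each unit of k removes 2 from both sides.
⌈/2⌉+-≤ : ∀ m k s → m + 2 * k ≤ 2 * s → ⌈ m /2⌉ + k ≤ s
⌈/2⌉+-≤ m zero    s h = subst₂ _≤_ (sym (+-identityʳ _))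
    (trans (cong (λ v → ⌈ s + v /2⌉) (+-identityʳ s)) (sym (n≡⌈n+n/2⌉ s)))
    (⌈n/2⌉-mono (subst (_≤ 2 * s) (+-identityʳ m) h))
⌈/2⌉+-≤ m (suc k) zero    h = contradiction (≤-trans (m≤n+m _ m) h) λ ()
⌈/2⌉+-≤ m (suc k) (suc s) h = subst (_≤ suc s) (sym (+-suc ⌈ m /2⌉ k)) (s≤s (⌈/2⌉+-≤ m k s
    (+-cancelˡ-≤ 2 _ _ (subst₂ _≤_ (lhs m k) (rhs s) h))))
  where
  lhs : ∀ m k → m + 2 * suc k ≡ 2 + (m + 2 * k)
  lhs = solve-∀
  rhs : ∀ s → 2 * suc s ≡ 2 + 2 * s
  rhs = solve-∀

sum-sgn : ∀ {n} (c : Fin n → Bool) → sumℤ (sgn ∘ c) ≡ ⁺ count c -ℤ ⁺ count (not ∘ c)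
sum-sgn {zero}  c = refl
sum-sgn {suc n} c with c zero
... | true  = trans (cong (1ℤ +ℤ_) (sum-sgn (c ∘ suc))) (ring (⁺ count (c ∘ suc)) (⁺ count (not ∘ c ∘ suc)))
  where
  ring : ∀ a b → 1ℤ +ℤ (a -ℤ b) ≡ (1ℤ +ℤ a) -ℤ b
  ring = ℤSolver.solve-∀
... | false = trans (cong (-1ℤ +ℤ_) (sum-sgn (c ∘ suc))) (ring (⁺ count (c ∘ suc)) (⁺ count (not ∘ c ∘ suc)))
  where
  ring : ∀ a b → -1ℤ +ℤ (a -ℤ b) ≡ a -ℤ (1ℤ +ℤ b)
  ring = ℤSolver.solve-∀

-- Graphs without a majority class of twins

term≤sum : ∀ {n} (f : Fin n → ℕ) i → f i ≤ sum f
term≤sum f zero    = m≤m+n _ _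
term≤sum f (suc i) = ≤-trans (term≤sum (f ∘ suc) i) (m≤n+m _ _)

count≡0⇒false : ∀ {n} (p : Fin n → Bool) → count p ≡ 0 → ∀ i → p i ≡ false
count≡0⇒false p c≡0 i with p i in eq
... | false = refl
... | true  = contradiction (subst₂ (λ a b → bit a ≤ b) eq c≡0 (term≤sum (bit ∘ p) i)) λ ()

count≡suc⇒∃ : ∀ {n m} (p : Fin n → Bool) → count p ≡ suc m → ∃[ i ] p i ≡ true
count≡suc⇒∃ {suc n} p c≡ with p zero in eq
... | true  = zero , eq
... | false = let i , pi = count≡suc⇒∃ (p ∘ suc) c≡ in suc i , pi

erase : ∀ {n} → (Fin n → Bool) → Fin n → Fin n → Bool
erase p x i = p i ∧ not (does (i ≟ᶠ x))

erase-≢ : ∀ {n} (p : Fin n → Bool) {x i} → i ≢ x → p i ≡ erase p x i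
erase-≢ p {x} {i} i≢x = sym (trans (cong (λ b → p i ∧ not b) (dec-false (i ≟ᶠ x) i≢x)) (Bool.∧-identityʳ (p i)))

erase-self : ∀ {n} (p : Fin n → Bool) x → erase p x x ≡ false
erase-self p x = trans (cong (λ b → p x ∧ not b) (dec-true (x ≟ᶠ x) refl)) (Bool.∧-zeroʳ (p x))

count-erase-self : ∀ {n} (p : Fin n → Bool) x → p x ≡ true → count p ≡ suc (count (erase p x))
count-erase-self p x px = count-erase {p = p} {q = erase p x} x px (erase-self p x) λ i → erase-≢ p

count≥2 : ∀ {n} (f : Fin n → Bool) {p q} → p ≢ q → f p ≡ true → f q ≡ true → ∃[ m ] count f ≡ 2 + m
count≥2 f {p} {q} p≢q fp fq = _ , trans (count-erase-self f p fp)
    (cong suc (count-erase-self (erase f p) q (trans (sym (erase-≢ f (p≢q ∘ sym))) fq)))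

-- Turns an alternative at each vertex into either one certificate or a bound valid at all vertices,
-- without classical logic.
⊎-∀ : ∀ {n} {A : Set} {B : Fin n → Set} → (∀ i → A ⊎ B i) → A ⊎ (∀ i → B i)
⊎-∀ {zero}  f = inj₂ λ ()
⊎-∀ {suc n} f with f zero | ⊎-∀ (f ∘ suc)
... | inj₁ a  | _       = inj₁ a
... | inj₂ _  | inj₁ a  = inj₁ a
... | inj₂ b₀ | inj₂ bs = inj₂ λ { zero → b₀ ; (suc i) → bs i }

-- The surplus may only be on the `false` side, since a bisection requires |X| ≤ |Y|; a colouring of
-- sum +1 has to be complemented first.
balanced-by-sum : ∀ {n} (c : Fin n → Bool) → sumℤ (sgn ∘ c) ≡ 0ℤ ⊎ sumℤ (sgn ∘ c) ≡ -1ℤ → Balanced c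
balanced-by-sum c (inj₁ eq) = record { lower = ≤-reflexive a≡b ; upper = ≤-trans (≤-reflexive (sym a≡b)) (m≤m+n _ 1) }
  where
  a≡b : count c ≡ count (not ∘ c)
  a≡b = ℤ.+-injective (ℤ.i-j≡0⇒i≡j _ _ (trans (sym (sum-sgn c)) eq))
balanced-by-sum c (inj₂ eq) = record { lower = ≤-trans (m≤m+n _ 1) (≤-reflexive a+1≡b) ; upper = ≤-reflexive (sym a+1≡b) }
  where
  ring : ∀ a b → (a +ℤ 1ℤ) -ℤ b ≡ (a -ℤ b) +ℤ 1ℤ
  ring = ℤSolver.solve-∀
  a+1≡b : count c + 1 ≡ count (not ∘ c)
  a+1≡b = ℤ.+-injective (ℤ.i-j≡0⇒i≡j _ _
      (trans (ring (⁺ count c) (⁺ count (not ∘ c))) (cong (_+ℤ 1ℤ) (trans (sym (sum-sgn c)) eq))))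

sum-sgn-not : ∀ {n} (c : Fin n → Bool) → sumℤ (sgn ∘ not ∘ c) ≡ ℤ.- sumℤ (sgn ∘ c)
sum-sgn-not c = begin
  sumℤ (sgn ∘ not ∘ c)                               ≡⟨ sum-sgn (not ∘ c) ⟩
  ⁺ count (not ∘ c) -ℤ ⁺ count (not ∘ not ∘ c)
    ≡⟨ cong (λ v → ⁺ count (not ∘ c) -ℤ ⁺ v) (count-cong (not-involutive ∘ c)) ⟩
  ⁺ count (not ∘ c) -ℤ ⁺ count c                     ≡⟨ ring (⁺ count c) (⁺ count (not ∘ c)) ⟩
  ℤ.- (⁺ count c -ℤ ⁺ count (not ∘ c))               ≡⟨ cong ℤ.-_ (sum-sgn c) ⟨
  ℤ.- sumℤ (sgn ∘ c)                                 ∎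
  where
  open ≡-Reasoning
  ring : ∀ a b → b -ℤ a ≡ ℤ.- (a -ℤ b)
  ring = ℤSolver.solve-∀

-- Equal open neighbourhoods; as the diagonal is `false`, twins are never adjacent.
twin : (G : Graph) → Fin (∣V∣ G) → Fin (∣V∣ G) → Bool
twin G v w = does (all? λ j → Graph.adj G v j Bool.≟ Graph.adj G w j)

twin⇒≡ : ∀ G {v w} → twin G v w ≡ true → ∀ j → Graph.adj G v j ≡ Graph.adj G w j
twin⇒≡ G = witness (all? _)
  where
  witness : {P : Set} (P? : Dec P) → does P? ≡ true → P
  witness (yes p) _ = p

≡⇒twin : ∀ G {v w} → (∀ j → Graph.adj G v j ≡ Graph.adj G w j) → twin G v w ≡ true
≡⇒twin G {v} {w} p = dec-true (all? λ j → Graph.adj G v j Bool.≟ Graph.adj G w j) p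

-- (n + 1)/2 bounds the larger side of a bisection: a class beyond it cannot lie on one side.
NoMajorityTwins : Graph → Set
NoMajorityTwins G = ∀ v → 2 * count (twin G v) ≤ suc (∣V∣ G)

module Completion (G : Graph) where

  private module G = Graph G
  open G using (order; adj)
  open Form G
  open Signing

  -- Substituting 2m for `vol` and 2s for `cutVol` turns Q ≤ -4k into m + 2k ≤ 2s.
  colour⇒cutVol : ∀ k c → Q (sgn ∘ c) +ℤ ⁺ (4 * k) ≤ℤ 0ℤ → 2 * (⌈ ∣E∣ G /2⌉ + k) ≤ cutVol G c
  colour⇒cutVol k c Q≤ with cutVol-even c | vol≡Q+2cutVol c
  ... | s , cut≡ | vol≡ = ≤-trans (*-monoʳ-≤ 2 (⌈/2⌉+-≤ (∣E∣ G) k s (*-cancelˡ-≤ 2 2E+4k≤4s))) (≤-reflexive (sym cut≡))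
    where
    ring : ∀ q a b → (q +ℤ a) +ℤ b ≡ (q +ℤ b) +ℤ a
    ring = ℤSolver.solve-∀
    vol+4k≤2cut : vol G + 4 * k ≤ 2 * cutVol G c
    vol+4k≤2cut = ℤ.drop‿+≤+ (begin
      ⁺ vol G +ℤ ⁺ (4 * k)                                ≡⟨ cong (_+ℤ ⁺ (4 * k)) vol≡ ⟩
      Q (sgn ∘ c) +ℤ ⁺ (2 * cutVol G c) +ℤ ⁺ (4 * k)      ≡⟨ ring (Q (sgn ∘ c)) (⁺ (2 * cutVol G c)) (⁺ (4 * k)) ⟩
      Q (sgn ∘ c) +ℤ ⁺ (4 * k) +ℤ ⁺ (2 * cutVol G c)      ≤⟨ ℤ.+-monoˡ-≤ (⁺ (2 * cutVol G c)) Q≤ ⟩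
      ⁺ (2 * cutVol G c)                                  ∎)
      where open ℤ.≤-Reasoning
    2E+4k≤4s : 2 * (∣E∣ G + 2 * k) ≤ 2 * (2 * s)
    2E+4k≤4s = subst₂ _≤_ (trans (cong (_+ 4 * k) (sym (vol≡2∣E∣ G))) (lem (∣E∣ G) k)) (cong (2 *_) cut≡) vol+4k≤2cut
      where
      lem : ∀ e k → 2 * e + 4 * k ≡ 2 * (e + 2 * k)
      lem = solve-∀

  Full : (Fin order → ℤ) → Set
  Full x = ∀ i → isZero (x i) ≡ false

  full⇒cuttable : ∀ k {x} → (∀ i → Trit (x i)) → Full x → sumℤ x ≡ 0ℤ ⊎ ∃[ b ] sumℤ x ≡ sgn b →
                  Q x +ℤ ⁺ (4 * k) ≤ℤ 0ℤ → Yes G k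
  full⇒cuttable k {x} t full s Q≤ = pick s
    where
    c : Fin order → Bool
    c = toColour ∘ x
    sgn∘c≗x : sgn ∘ c ≗ x
    sgn∘c≗x i = sgn-toColour (t i) (full i)
    cut≤ : 2 * (⌈ ∣E∣ G /2⌉ + k) ≤ cutVol G c
    cut≤ = colour⇒cutVol k c (subst (λ q → q +ℤ ⁺ (4 * k) ≤ℤ 0ℤ) (sym (Q-cong sgn∘c≗x)) Q≤)
    sum≡ : sumℤ (sgn ∘ c) ≡ sumℤ x
    sum≡ = sumℤ-cong sgn∘c≗x
    pick : sumℤ x ≡ 0ℤ ⊎ ∃[ b ] sumℤ x ≡ sgn b → Yes G k
    pick (inj₁ e)           = c , balanced-by-sum c (inj₁ (trans sum≡ e)) , cut≤
    pick (inj₂ (false , e)) = c , balanced-by-sum c (inj₂ (trans sum≡ e)) , cut≤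
    -- The `true` side is larger by one, so the two sides are exchanged; the cut is symmetric in
    -- them.
    pick (inj₂ (true , e))  = not ∘ c ,
      balanced-by-sum (not ∘ c) (inj₂ (trans (sum-sgn-not c) (cong ℤ.-_ (trans sum≡ e)))) ,
      ≤-trans cut≤ (≤-reflexive (sym (cutVol-not c)))

  -- Uncoloured vertices are removed two at a time by `extendPair`, whose possible gain from an edge
  -- is dropped here. A single last vertex takes the sign opposing its pull, and the resulting
  -- imbalance of one is what a bisection allows.
  signing⇒cuttable : ∀ k z {x} → Signing x z → Q x +ℤ ⁺ (4 * k) ≤ℤ 0ℤ → Yes G k
  signing⇒cuttable k zero {x} σ Q≤ = full⇒cuttable k (σ .trit) (count≡0⇒false (isZero ∘ x) (σ .#zeros)) (inj₁ (σ .sum≡0)) Q≤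
  signing⇒cuttable k (suc zero) {x} σ Q≤ =
    full⇒cuttable k {addAt x p (sgn b)} (trit-addAt {x} p b (σ .trit) xp)
        (count≡0⇒false (isZero ∘ addAt x p (sgn b)) (zeros-addAt {x} p b xp (σ .#zeros)))
      (inj₂ (b , trans (sum-addAt x p (sgn b)) (trans (cong (_+ℤ sgn b) (σ .sum≡0)) (ℤ.+-identityˡ _))))
      (ℤ.≤-trans (ℤ.+-monoˡ-≤ (⁺ (4 * k)) Qy≤Qx) Q≤)
    where
    p = proj₁ (count≡suc⇒∃ (isZero ∘ x) (σ .#zeros))
    xp : x p ≡ 0ℤ
    xp = isZero⇒≡0 (proj₂ (count≡suc⇒∃ (isZero ∘ x) (σ .#zeros)))
    b = proj₁ (chooseSign (pull x p))
    Qy≤Qx : Q (addAt x p (sgn b)) ≤ℤ Q x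
    Qy≤Qx = begin
      Q (addAt x p (sgn b))               ≡⟨ Q-addAt x p (sgn b) ⟩
      Q x +ℤ ⁺ 2 *ℤ (sgn b *ℤ pull x p)   ≤⟨ ℤ.+-monoʳ-≤ (Q x) (ℤ.*-monoˡ-≤-nonNeg (⁺ 2) (proj₂ (chooseSign (pull x p)))) ⟩
      Q x +ℤ ⁺ 2 *ℤ 0ℤ                    ≡⟨ ℤ.+-identityʳ (Q x) ⟩
      Q x                                 ∎
      where open ℤ.≤-Reasoning
  signing⇒cuttable k (suc (suc z)) {x} σ Q≤ =
    signing⇒cuttable k z (proj₁ (proj₂ ext)) (ℤ.≤-trans (ℤ.+-monoˡ-≤ (⁺ (4 * k)) Qy≤Qx) Q≤)
    where
    f = isZero ∘ x
    first = count≡suc⇒∃ (isZero ∘ x) (σ .#zeros)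
    p = proj₁ first
    second = count≡suc⇒∃ (erase f p) (suc-injective (trans (sym (count-erase-self f p (proj₂ first))) (σ .#zeros)))
    q = proj₁ second
    p≢q : p ≢ q
    p≢q p≡q = contradiction (trans (sym (erase-self f p)) (subst (λ r → erase f p r ≡ true) (sym p≡q) (proj₂ second))) λ ()
    fq : f q ≡ true
    fq = trans (erase-≢ f (p≢q ∘ sym)) (proj₂ second)
    ext = extendPair {x} {z} {p} {q} σ p≢q (isZero⇒≡0 (proj₂ first)) (isZero⇒≡0 fq)
    y = proj₁ ext
    Qy≤Qx : Q y ≤ℤ Q x
    Qy≤Qx = ℤ.≤-trans (ℤ.≤-trans (ℤ.≤-reflexive (sym (ℤ.+-identityʳ (Q y)))) (ℤ.+-monoʳ-≤ (Q y) (0≤2w (adj p q))))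
        (proj₂ (proj₂ ext))
      where
      0≤2w : ∀ a → 0ℤ ≤ℤ ⁺ 2 *ℤ ⁺ bit a
      0≤2w true  = +≤+ z≤n
      0≤2w false = +≤+ z≤n

  -- It is the complement of `C` that spans no edge, so this says that `C` is a vertex cover.
  Independent : (Fin order → Bool) → Set
  Independent C = ∀ i j → C i ≡ false → C j ≡ false → adj i j ≡ false

  -- A matching with m edges, remembered only through its effect: its 2m endpoints are coloured, and
  -- each edge has lowered `Q` by at least 2.
  Matched : ℕ → Set
  Matched m = ∃[ x ] ∃[ z ] Signing x z × z + 2 * m ≡ order × Q x +ℤ ⁺ (2 * m) ≤ℤ 0ℤ

  Cover : ℕ → Set
  Cover m = ∃[ C ] count C ≤ 2 * m × Independent C

  FreeEdge : (Fin order → ℤ) → Set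
  FreeEdge x = ∃[ p ] ∃[ q ] isZero (x p) ≡ true × isZero (x q) ≡ true × adj p q ≡ true

  freeEdge? : ∀ x → Dec (FreeEdge x)
  freeEdge? x = any? λ p → any? λ q → (isZero (x p) Bool.≟ true) ×-dec (isZero (x q) Bool.≟ true) ×-dec (adj p q Bool.≟ true)

  addFreeEdge : ∀ {m} ((x , _) : Matched m) → FreeEdge x → Matched (suc m)
  addFreeEdge {m} (x , z , σ , z+ , Q≤) (p , q , xp , xq , apq) =
    y , z′ , proj₁ (proj₂ ext) , trans (lem z′ m) (trans (cong (_+ 2 * m) (trans (sym z≡) (σ .#zeros))) z+) , Q≤′
    where
    p≢q : p ≢ q
    p≢q p≡q = contradiction (trans (sym (G.irrefl p)) (subst (λ r → adj p r ≡ true) (sym p≡q) apq)) λ ()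
    two = count≥2 (isZero ∘ x) p≢q xp xq
    z′ = proj₁ two
    z≡ = proj₂ two
    ext = extendPair {x} {z′} {p} {q} (record { trit = σ .trit ; sum≡0 = σ .sum≡0 ; #zeros = z≡ }) p≢q (isZero⇒≡0 xp)
        (isZero⇒≡0 xq)
    y = proj₁ ext
    lem : ∀ z m → z + 2 * suc m ≡ 2 + z + 2 * m
    lem = solve-∀
    Q≤′ : Q y +ℤ ⁺ (2 * suc m) ≤ℤ 0ℤ
    Q≤′ = begin
      Q y +ℤ ⁺ (2 * suc m)                      ≡⟨ cong (λ v → Q y +ℤ ⁺ v) (*-suc 2 m) ⟩
      Q y +ℤ (⁺ 2 +ℤ ⁺ (2 * m))                 ≡⟨ ℤ.+-assoc (Q y) (⁺ 2) (⁺ (2 * m)) ⟨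
      Q y +ℤ ⁺ 2 +ℤ ⁺ (2 * m)                   ≡⟨ cong (λ a → Q y +ℤ ⁺ 2 *ℤ ⁺ bit a +ℤ ⁺ (2 * m)) apq ⟨
      Q y +ℤ ⁺ 2 *ℤ weight p q +ℤ ⁺ (2 * m)     ≤⟨ ℤ.+-monoˡ-≤ (⁺ (2 * m)) (proj₂ (proj₂ ext)) ⟩
      Q x +ℤ ⁺ (2 * m)                          ≤⟨ Q≤ ⟩
      0ℤ                                        ∎
      where open ℤ.≤-Reasoning

  -- The coloured vertices are the endpoints of the matching; an edge avoiding all of them would be
  -- free.
  maximal⇒cover : ∀ {m} ((x , _) : Matched m) → ¬ FreeEdge x → Cover m
  maximal⇒cover {m} (x , z , σ , z+ , _) none = not ∘ isZero ∘ x , ≤-reflexive C≡ , ind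
    where
    C≡ : count (not ∘ isZero ∘ x) ≡ 2 * m
    C≡ = +-cancelˡ-≡ z _ _ (trans (trans (cong (_+ count (not ∘ isZero ∘ x)) (sym (σ .#zeros)))
        (count-not (isZero ∘ x))) (sym z+))
    not-false : ∀ {b} → not b ≡ false → b ≡ true
    not-false {true} _ = refl
    ind : Independent (not ∘ isZero ∘ x)
    ind i j ¬ci ¬cj = ¬-not λ aij → none (i , j , not-false ¬ci , not-false ¬cj , aij)

  enlarge : ∀ {m} → Cover m → Cover (suc m)
  enlarge {m} (C , C≤ , ind) = C , ≤-trans C≤ (*-monoʳ-≤ 2 (n≤1+n m)) , ind

  -- Greedy construction. A cover found early survives, because the bound in `Cover` grows with m.
  matching-or-cover : ∀ m → Matched m ⊎ Cover m
  matching-or-cover zero = inj₁ (_ , order , zeroSigning , +-identityʳ order ,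
    ℤ.≤-reflexive (trans (ℤ.+-identityʳ _) Q-zero))
  matching-or-cover (suc m) = case matching-or-cover m of λ where
    (inj₂ cover) → inj₂ (enlarge {m} cover)
    (inj₁ M)     → case freeEdge? (proj₁ M) of λ where
      (yes e)   → inj₁ (addFreeEdge {m} M e)
      (no none) → inj₂ (enlarge {m} (maximal⇒cover {m} M none))

  -- The vertices outside `C` whose adjacency to u differs from b: neighbours of u for b = `false`,
  -- non-neighbours for b = `true`.
  exception : (Fin order → Bool) → Bool → Fin order → Fin order → Bool
  exception C b u j = not (C j) ∧ (b xor adj u j)

  -- Put u opposite to m + 1 of its neighbours outside C, together with m non-neighbours:
  -- only the edges from u to those neighbours lie inside the coloured set.
  star : ∀ {C} u m → Independent C → C u ≡ true →
         suc m ≤ count (exception C false u) → m ≤ count (exception C true u) →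
         ∃[ x ] ∃[ z ] Signing x z × Q x +ℤ ⁺ (2 * suc m) ≤ℤ 0ℤ
  star {C} u m ind Cu A≤ B≤ with count-choose (exception C false u) (suc m) A≤ | count-choose (exception C true u) m B≤
  ... | A , A⇒ , cA | B , B⇒ , cB = x , count (isZero ∘ x) , record
      { trit   = trit-addAt u true trit-y yu
      ; sum≡0  = trans (sum-addAt y u 1ℤ)
          (trans (cong (_+ℤ 1ℤ) (trans sum-y (cong₂ (λ a b → ⁺ b +ℤ -1ℤ *ℤ ⁺ a) cA cB))) (ring (⁺ m)))
      ; #zeros = refl }
    , ℤ.≤-reflexive (trans (cong (_+ℤ ⁺ (2 * suc m)) Qx) (ring′ m))
    where
    -- The support of y avoids `C`, so `Q y` = 0; its sum is m - (m + 1) = -1, which the colour +1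
    -- at u repairs. As u sees only A, `Q x` = -2(m + 1).
    y : Fin order → ℤ
    y i = ⁺ bit (B i) +ℤ -1ℤ *ℤ ⁺ bit (A i)
    x = addAt y u 1ℤ
    ∧-true : ∀ {a b} → a ∧ b ≡ true → a ≡ true × b ≡ true
    ∧-true {true} {true} _ = refl , refl
    notC : ∀ {b j} → exception C b u j ≡ true → C j ≡ false
    notC {b} {j} e with C j
    ... | false = refl
    pair : ∀ a b → (a ≡ true → b ≡ true → ∀ {P : Set} → P) → Trit (⁺ bit b +ℤ -1ℤ *ℤ ⁺ bit a)
    pair true  true  h = h refl refl
    pair true  false h = sig false
    pair false true  h = sig true
    pair false false h = nil
    disjoint : ∀ i → A i ≡ true → B i ≡ true → ∀ {P : Set} → P
    disjoint i Ai Bi with adj u i | proj₂ (∧-true {not (C i)} (A⇒ i Ai)) | proj₂ (∧-true {not (C i)} (B⇒ i Bi))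
    ... | true | _ | ()
    ... | false | () | _
    trit-y : ∀ i → Trit (y i)
    trit-y i = pair (A i) (B i) (disjoint i)
    zero-on-C : ∀ i → C i ≡ true → y i ≡ 0ℤ
    zero-on-C i Ci = cong₂ (λ a b → ⁺ bit b +ℤ -1ℤ *ℤ ⁺ bit a) (off false A⇒) (off true B⇒)
      where
      off : ∀ b {D : Fin order → Bool} → (∀ j → D j ≡ true → exception C b u j ≡ true) → D i ≡ false
      off b D⇒ = ¬-not λ Di → contradiction (trans (sym Ci) (notC {b} (D⇒ i Di))) λ ()
    yu : y u ≡ 0ℤ
    yu = zero-on-C u Cu
    sum-y : sumℤ y ≡ ⁺ count B +ℤ -1ℤ *ℤ ⁺ count A
    sum-y = trans (sumℤ-+ (⁺_ ∘ bit ∘ B) _) (cong₂ _+ℤ_ (sym (sum⇒sumℤ (bit ∘ B)))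
      (trans (sym (sumℤ-*ˡ -1ℤ (⁺_ ∘ bit ∘ A))) (cong (-1ℤ *ℤ_) (sym (sum⇒sumℤ (bit ∘ A))))))
    ring : ∀ m → m +ℤ -1ℤ *ℤ (1ℤ +ℤ m) +ℤ 1ℤ ≡ 0ℤ
    ring = ℤSolver.solve-∀
    pull-y : pull y u ≡ -1ℤ *ℤ ⁺ suc m
    pull-y = trans (sumℤ-cong term)
        (trans (sym (sumℤ-*ˡ -1ℤ (⁺_ ∘ bit ∘ A))) (cong (-1ℤ *ℤ_) (trans (sym (sum⇒sumℤ (bit ∘ A))) (cong ⁺_ cA))))
      where
      term : ∀ j → weight u j *ℤ y j ≡ -1ℤ *ℤ ⁺ bit (A j)
      term j with A j | B j | adj u j | (λ e → proj₂ (∧-true {not (C j)} (A⇒ j e))) |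
          (λ e → proj₂ (∧-true {not (C j)} (B⇒ j e)))
      ... | true  | true  | true  | _ | h = contradiction (h refl) λ ()
      ... | true  | false | true  | _ | _ = refl
      ... | true  | _     | false | h | _ = contradiction (h refl) λ ()
      ... | false | true  | true  | _ | h = contradiction (h refl) λ ()
      ... | false | true  | false | _ | _ = refl
      ... | false | false | true  | _ | _ = refl
      ... | false | false | false | _ | _ = refl
    Q-y : Q y ≡ 0ℤ
    Q-y = trans (sumℤ-cong vanish) (sumℤ-zero order)
      where
      vanish : ∀ i → y i *ℤ pull y i ≡ 0ℤ
      vanish i = case C i Bool.≟ true of λ where
        (yes Ci) → trans (cong (_*ℤ pull y i) (zero-on-C i Ci)) (ℤ.*-zeroˡ (pull y i))
        (no ¬Ci) → trans (cong (y i *ℤ_) (trans (sumℤ-cong λ j → case C j Bool.≟ true of λ where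
                        (yes Cj) → trans (cong (weight i j *ℤ_) (zero-on-C j Cj)) (ℤ.*-zeroʳ (weight i j))
                        (no ¬Cj) → trans (cong (λ a → ⁺ bit a *ℤ y j) (ind i j (¬-not ¬Ci) (¬-not ¬Cj))) (ℤ.*-zeroˡ (y j)))
                      (sumℤ-zero order))) (ℤ.*-zeroʳ (y i))
    Qx : Q x ≡ ⁺ 2 *ℤ (1ℤ *ℤ (-1ℤ *ℤ ⁺ suc m))
    Qx = trans (Q-addAt y u 1ℤ) (trans (cong₂ (λ a b → a +ℤ ⁺ 2 *ℤ (1ℤ *ℤ b)) Q-y pull-y) (ℤ.+-identityˡ _))
    ring′ : ∀ m → ⁺ 2 *ℤ (1ℤ *ℤ (-1ℤ *ℤ ⁺ suc m)) +ℤ ⁺ (2 * suc m) ≡ 0ℤ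
    ring′ m = trans (cong ((⁺ 2 *ℤ (1ℤ *ℤ (-1ℤ *ℤ ⁺ suc m))) +ℤ_) (ℤ.pos-* 2 (suc m))) (ring″ (⁺ suc m))
      where
      ring″ : ∀ v → ⁺ 2 *ℤ (1ℤ *ℤ (-1ℤ *ℤ v)) +ℤ ⁺ 2 *ℤ v ≡ 0ℤ
      ring″ = ℤSolver.solve-∀

  -- Every nonzero entry has its row or its column in `C`.
  vol-cover : ∀ {C} → Independent C → vol G ≤ 2 * (order * count C)
  vol-cover {C} ind = begin
    vol G                                                        ≤⟨ sum-mono {order} (λ i → sum-mono {order} (covered i)) ⟩
    ∑[ i < order ] ∑[ j < order ] (bit (C i) + bit (C j))
      ≡⟨ sum-cong-≗ {order} (λ i → ∑-distrib-+ (λ _ → bit (C i)) (bit ∘ C)) ⟩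
    ∑[ i < order ] (∑[ j < order ] bit (C i) + count C)
      ≡⟨ ∑-distrib-+ {order} (λ i → ∑[ j < order ] bit (C i)) (λ _ → count C) ⟩
    ∑[ i < order ] (∑[ j < order ] bit (C i)) + ∑[ i < order ] count C
      ≡⟨ cong₂ _+_ (trans (sum-cong-≗ {order} (λ i → sum-const order (bit (C i))))
          (sym (*-distribˡ-sum order (bit ∘ C)))) (sum-const order (count C)) ⟩
    order * count C + order * count C                            ≡⟨ cong (λ v → order * count C + v) (+-identityʳ _) ⟨
    2 * (order * count C)                                        ∎
    where
    open ≤-Reasoning
    covered : ∀ i j → bit (adj i j) ≤ bit (C i) + bit (C j)
    covered i j with C i in ci | C j in cj
    ... | true  | _     = ≤-trans (bit-mono {adj i j} {true} (λ _ → refl)) (m≤m+n 1 _)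
    ... | false | true  = bit-mono {adj i j} {true} (λ _ → refl)
    ... | false | false = ≤-reflexive (cong bit (ind i j ci cj))

  -- The vertices outside `C` that are exceptional for no u in `C` are mutual twins, so there are at
  -- most (n + 1)/2 of them. The others number at most |C| + |C|·t; solving n ≤ |C| + |C|·t + (n +
  -- 1)/2 for n gives the bound.
  few-exceptions : ∀ {C} t → NoMajorityTwins G → Independent C → (b : Fin order → Bool) →
    (∀ u → C u ≡ true → count (exception C (b u) u) ≤ t) →
    order ≤ 2 * (count C + count C * t) + 1
  few-exceptions {C} t noMaj ind b few = arith (count C) (count Tw) (count C * t) n≤ 2Tw≤
    where
    ex : Fin order → Fin order → Bool
    ex u j = C u ∧ exception C (b u) u j
    any-ex = λ j → any? λ u → ex u j Bool.≟ true
    Tw : Fin order → Bool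
    Tw j = not (C j) ∧ not (does (any-ex j))
    -- Union bound: each vertex is in `C`, in `Tw`, or exceptional for some u.
    pointwise : ∀ j → 1 ≤ bit (C j) + bit (Tw j) + ∑[ u < order ] bit (ex u j)
    pointwise j = cases (C j) (any-ex j)
      where
      cases : ∀ c (d : Dec (∃[ u ] ex u j ≡ true)) → 1 ≤ bit c + bit (not c ∧ not (does d)) + ∑[ u < order ] bit (ex u j)
      cases true  d             = s≤s z≤n
      cases false (no _)        = s≤s z≤n
      cases false (yes (u , e)) = ≤-trans (≤-reflexive (sym (cong bit e))) (term≤sum (λ u → bit (ex u j)) u)
    ex≤ : ∀ u → count (ex u) ≤ bit (C u) * t
    ex≤ u with C u in eq
    ... | true  = ≤-trans (few u eq) (≤-reflexive (sym (+-identityʳ t)))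
    ... | false = ≤-reflexive (trans (sum-const order 0) (*-zeroʳ order))
    n≤ : order ≤ count C + count Tw + count C * t
    n≤ = begin
      order
        ≡⟨ trans (sum-const order 1) (*-identityʳ order) ⟨
      ∑[ j < order ] 1                                                      ≤⟨ sum-mono pointwise ⟩
      ∑[ j < order ] (bit (C j) + bit (Tw j) + ∑[ u < order ] bit (ex u j))
        ≡⟨ ∑-distrib-+ {order} (λ j → bit (C j) + bit (Tw j)) (λ j → ∑[ u < order ] bit (ex u j)) ⟩
      ∑[ j < order ] (bit (C j) + bit (Tw j)) + ∑[ j < order ] ∑[ u < order ] bit (ex u j)
        ≡⟨ cong₂ _+_ (∑-distrib-+ {order} (bit ∘ C) (bit ∘ Tw)) (∑-comm {order} {order} (λ j u → bit (ex u j))) ⟩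
      count C + count Tw + ∑[ u < order ] count (ex u)
        ≤⟨ +-monoʳ-≤ (count C + count Tw) (sum-mono {order} ex≤) ⟩
      count C + count Tw + ∑[ u < order ] (bit (C u) * t)
        ≡⟨ cong (λ v → count C + count Tw + v) (*-distribʳ-sum t (bit ∘ C)) ⟨
      count C + count Tw + count C * t                                      ∎
      where open ≤-Reasoning
    -- The right-hand side does not depend on v. Outside `C` it comes from independence; at j in `C`
    -- it holds because v is not exceptional for j.
    Tw-row : ∀ {v} → Tw v ≡ true → ∀ j → adj v j ≡ C j ∧ b j
    Tw-row {v} tv j = cases (C v) (any-ex v) (C j) refl refl tv
      where
      xor-false : ∀ b a → b xor a ≡ false → a ≡ b
      xor-false true  true  _ = refl
      xor-false false false _ = refl
      cases : ∀ c (d : Dec (∃[ u ] ex u v ≡ true)) c′ → C v ≡ c → C j ≡ c′ → not c ∧ not (does d) ≡ true → adj v j ≡ c′ ∧ b j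
      cases false (no none) false cv cj _ = ind v j cv cj
      cases false (no none) true  cv cj _ = trans (G.sym v j) (xor-false (b j) (adj j v)
        (¬-not λ e → none (j , trans (cong₂ (λ c d → c ∧ (not d ∧ (b j xor adj j v))) cj cv) e)))
    2Tw≤ : 2 * count Tw ≤ suc order
    2Tw≤ with count Tw in eq
    ... | zero  = z≤n
    ... | suc m = let v , tv = count≡suc⇒∃ Tw eq in
      ≤-trans (*-monoʳ-≤ 2 (≤-trans (≤-reflexive (sym eq))
          (count-mono {p = Tw} {q = twin G v} λ w tw → ≡⇒twin G λ j → trans (Tw-row tv j) (sym (Tw-row tw j)))))
          (noMaj v)
    arith : ∀ c t e → order ≤ c + t + e → 2 * t ≤ suc order → order ≤ 2 * (c + e) + 1
    arith c t e h h′ = +-cancelˡ-≤ order _ _ (begin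
      order + order                  ≡⟨ cong (λ v → order + v) (+-identityʳ order) ⟨
      2 * order                      ≤⟨ *-monoʳ-≤ 2 h ⟩
      2 * (c + t + e)                ≡⟨ r₁ c t e ⟩
      2 * (c + e) + 2 * t            ≤⟨ +-monoʳ-≤ (2 * (c + e)) h′ ⟩
      2 * (c + e) + suc order        ≡⟨ r₂ (2 * (c + e)) order ⟩
      order + (2 * (c + e) + 1)      ∎)
      where
      open ≤-Reasoning
      r₁ : ∀ c t e → 2 * (c + t + e) ≡ 2 * (c + e) + 2 * t
      r₁ = solve-∀
      r₂ : ∀ a n → a + suc n ≡ n + (a + 1)
      r₂ = solve-∀

  signing⇒yes : ∀ k {x z} → Signing x z → Q x +ℤ ⁺ (2 * (2 * k)) ≤ℤ 0ℤ → Yes G k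
  signing⇒yes k {x} {z} σ Q≤ = signing⇒cuttable k z σ (subst (λ v → Q x +ℤ ⁺ v ≤ℤ 0ℤ) (sym (*-assoc 2 2 k)) Q≤)

  -- A star with m + 1 = 2k leaves has Q = -4k. If there is none at u, one of the two exception sets
  -- is small, and b is the adjacency value shared by the remaining vertices outside `C`.
  yes-or-few-exceptions : ∀ {C k m} → Independent C → suc m ≡ 2 * k →
    ∀ u → Yes G k ⊎ ∃[ b ] (C u ≡ true → count (exception C b u) ≤ 2 * k)
  yes-or-few-exceptions {C} {k} {m} ind sm≡ u =
    cases (C u Bool.≟ true) (suc m ≤? count (exception C false u)) (m ≤? count (exception C true u))
    where
    cases : Dec (C u ≡ true) → Dec (suc m ≤ count (exception C false u)) → Dec (m ≤ count (exception C true u)) →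
            Yes G k ⊎ ∃[ b ] (C u ≡ true → count (exception C b u) ≤ 2 * k)
    cases (no ¬Cu) _ _ = inj₂ (true , λ Cu → contradiction Cu ¬Cu)
    cases (yes _) (no ≰) _ = inj₂ (false , λ _ → ≤-trans (≰⇒≥ ≰) (≤-reflexive sm≡))
    cases (yes _) _ (no ≰) = inj₂ (true , λ _ → ≤-trans (≰⇒≥ ≰) (≤-trans (n≤1+n m) (≤-reflexive sm≡)))
    cases (yes Cu) (yes A≤) (yes B≤) = let x , z , σ , Q≤ = star {C} u m ind Cu A≤ B≤ in
      inj₁ (signing⇒yes k σ (subst (λ v → Q x +ℤ ⁺ (2 * v) ≤ℤ 0ℤ) sm≡ Q≤))

  cover⇒vol≤ : ∀ {k} ((C , _) : Cover (2 * k)) → vol G ≤ 8 * (k * order)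
  cover⇒vol≤ {k} (C , C≤ , ind) = begin
    vol G                        ≤⟨ vol-cover ind ⟩
    2 * (order * count C)        ≤⟨ *-monoʳ-≤ 2 (*-monoʳ-≤ order C≤) ⟩
    2 * (order * (2 * (2 * k)))  ≡⟨ ring order k ⟩
    8 * (k * order)              ∎
    where
    open ≤-Reasoning
    ring : ∀ n k → 2 * (n * (2 * (2 * k))) ≡ 8 * (k * n)
    ring = solve-∀

  cover⇒order≤ : ∀ {k} → k ≤ k * k → NoMajorityTwins G → ((C , _) : Cover (2 * k)) →
    (∀ u → ∃[ b ] (C u ≡ true → count (exception C b u) ≤ 2 * k)) → order ≤ 32 * (k * k) + 1
  cover⇒order≤ {k} k≤k² noMaj (C , C≤ , ind) few = begin
    order                                                 ≤⟨ few-exceptions (2 * k) noMaj ind (proj₁ ∘ few) (proj₂ ∘ few) ⟩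
    2 * (count C + count C * (2 * k)) + 1                 ≤⟨ +-monoˡ-≤ 1 (*-monoʳ-≤ 2 (+-mono-≤ C≤ (*-monoˡ-≤ (2 * k) C≤))) ⟩
    2 * (2 * (2 * k) + 2 * (2 * k) * (2 * k)) + 1         ≡⟨ ring₁ k ⟩
    8 * k + 16 * (k * k) + 1
      -- 24k² would do; 32 is a power of two, which the program reaches by five doublings.
      ≤⟨ +-monoˡ-≤ 1 (+-monoˡ-≤ (16 * (k * k)) (*-mono-≤ (m≤m+n 8 8) k≤k²)) ⟩
    16 * (k * k) + 16 * (k * k) + 1                       ≡⟨ cong (_+ 1) (*-distribʳ-+ (k * k) 16 16) ⟨
    32 * (k * k) + 1                                      ∎
    where
    open ≤-Reasoning
    ring₁ : ∀ k → 2 * (2 * (2 * k) + 2 * (2 * k) * (2 * k)) + 1 ≡ 8 * k + 16 * (k * k) + 1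
    ring₁ = solve-∀

  -- The case k = 0 is separate because a star needs 2k ≥ 1; there the empty signing, with Q = 0,
  -- already extends to a bisection of size at least half the edges.
  cuttable-or-small : ∀ k → NoMajorityTwins G → Yes G k ⊎ (order ≤ 32 * (k * k) + 1 × vol G ≤ 8 * (k * order))
  cuttable-or-small zero noMaj = inj₁ (signing⇒yes 0 zeroSigning (ℤ.≤-reflexive (trans (ℤ.+-identityʳ _) Q-zero)))
  cuttable-or-small k@(suc k′) noMaj = case matching-or-cover (2 * k) of λ where
    (inj₁ (x , z , σ , _ , Q≤)) → inj₁ (signing⇒yes k σ Q≤)
    (inj₂ (C , C≤ , ind)) → case ⊎-∀ (yes-or-few-exceptions {C} {k} ind refl) of λ where
      (inj₁ y)   → inj₁ y
      (inj₂ few) → inj₂ (cover⇒order≤ {k} (m≤m*n k k) noMaj (C , C≤ , ind) few , cover⇒vol≤ {k} (C , C≤ , ind))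

-- Deleting twins

total : ∀ {n} → (Fin n → Fin n → Bool) → ℕ
total {n} f = ∑[ i < n ] count (f i)

minor : ∀ {n} → Fin (suc n) → (Fin (suc n) → Fin (suc n) → Bool) → Fin n → Fin n → Bool
minor x f i j = f (punchIn x i) (punchIn x j)

-- By symmetry the deleted column has the same count as the deleted row, and the diagonal entry they
-- share is zero.
total-minor : ∀ {n} (f : Fin (suc n) → Fin (suc n) → Bool) → (∀ i j → f i j ≡ f j i) → (∀ i → f i i ≡ false) →
              ∀ x → total f ≡ 2 * count (f x) + total (minor x f)
total-minor {n} f f-sym f-irrefl x = begin
  total f
    ≡⟨ sum-remove {i = x} (count ∘ f) ⟩
  count (f x) + ∑[ i < n ] count (f (punchIn x i))
    ≡⟨ cong (count (f x) +_) (sum-cong-≗ {n} λ i → count-remove x (f (punchIn x i))) ⟩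
  count (f x) + ∑[ i < n ] (bit (f (punchIn x i) x) + count (minor x f i))
    ≡⟨ cong (count (f x) +_) (∑-distrib-+ {n} (λ i → bit (f (punchIn x i) x)) (count ∘ minor x f)) ⟩
  count (f x) + (∑[ i < n ] bit (f (punchIn x i) x) + total (minor x f))
    ≡⟨ cong (λ v → count (f x) + (v + total (minor x f))) column ⟩
  count (f x) + (count (f x) + total (minor x f))
    ≡⟨ ring (count (f x)) (total (minor x f)) ⟩
  2 * count (f x) + total (minor x f) ∎
  where
  open ≡-Reasoning
  ring : ∀ a b → a + (a + b) ≡ 2 * a + b
  ring = solve-∀
  column : ∑[ i < n ] bit (f (punchIn x i) x) ≡ count (f x)
  column = trans (sum-cong-≗ {n} λ i → cong bit (f-sym (punchIn x i) x))
                 (sym (trans (count-remove x (f x)) (cong (λ b → bit b + count (f x ∘ punchIn x)) (f-irrefl x))))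

-- `p` is an index of the graph without `q`. As the entry joining the two vanishes, the row of the
-- second vertex loses nothing when `q` goes.
total-minor₂ : ∀ {n} (f : Fin (2 + n) → Fin (2 + n) → Bool) → (∀ i j → f i j ≡ f j i) → (∀ i → f i i ≡ false) →
               ∀ q p → f (punchIn q p) q ≡ false →
               total f ≡ 2 * (count (f q) + count (f (punchIn q p))) + total (minor p (minor q f))
total-minor₂ f f-sym f-irrefl q p fpq = begin
  total f                                                         ≡⟨ total-minor f f-sym f-irrefl q ⟩
  2 * count (f q) + total (minor q f)
    ≡⟨ cong (2 * count (f q) +_) (total-minor (minor q f) (λ i j → f-sym _ _) (λ i → f-irrefl _) p) ⟩
  2 * count (f q) + (2 * count (minor q f p) + total (minor p (minor q f)))
    ≡⟨ cong (λ v → 2 * count (f q) + (2 * v + total (minor p (minor q f)))) row ⟩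
  2 * count (f q) + (2 * count (f (punchIn q p)) + total (minor p (minor q f)))
    ≡⟨ ring (count (f q)) (count (f (punchIn q p))) (total (minor p (minor q f))) ⟩
  2 * (count (f q) + count (f (punchIn q p))) + total (minor p (minor q f)) ∎
  where
  open ≡-Reasoning
  ring : ∀ a b c → 2 * a + (2 * b + c) ≡ 2 * (a + b) + c
  ring = solve-∀
  row : count (minor q f p) ≡ count (f (punchIn q p))
  row = sym (trans (count-remove q (f (punchIn q p))) (cong (λ b → bit b + count (minor q f p)) fpq))

-- The order is an index here so that deleting a vertex computes.
record Adjacency (n : ℕ) : Set where
  field
    adj    : Fin n → Fin n → Bool
    sym-adj : ∀ i j → adj i j ≡ adj j i
    irrefl : ∀ i → adj i i ≡ false

open Adjacency

graph : ∀ {n} → Adjacency n → Graph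
graph {n} A = record { order = n ; adj = A .adj ; sym = A .sym-adj ; irrefl = A .irrefl }

fromGraph : (G : Graph) → Adjacency (∣V∣ G)
fromGraph G = record { adj = Graph.adj G ; sym-adj = Graph.sym G ; irrefl = Graph.irrefl G }

delete : ∀ {n} → Adjacency (suc n) → Fin (suc n) → Adjacency n
delete A x = record
  { adj = minor x (A .adj) ; sym-adj = λ i j → A .sym-adj _ _ ; irrefl = λ i → A .irrefl _ }

⌈2d+m/2⌉ : ∀ d m → ⌈ 2 * d + m /2⌉ ≡ d + ⌈ m /2⌉
⌈2d+m/2⌉ zero    m = refl
⌈2d+m/2⌉ (suc d) m = trans (cong (λ v → ⌈ v + m /2⌉) (*-suc 2 d)) (cong suc (⌈2d+m/2⌉ d m))

module TwinDeletion {n} (A : Adjacency (2 + n)) (q : Fin (2 + n)) (p′ : Fin (suc n))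
  (rows : ∀ j → A .adj (punchIn q p′) j ≡ A .adj q j) where

  private
    G = graph A
    G′ = graph (delete (delete A q) p′)
    p = punchIn q p′
    d = count (A .adj q)

  apq : A .adj p q ≡ false
  apq = trans (rows q) (A .irrefl q)

  restrict : (Fin (2 + n) → Bool) → Fin n → Bool
  restrict c = c ∘ punchIn q ∘ punchIn p′

  edges-deleted : ∣E∣ G ≡ 2 * d + ∣E∣ G′
  edges-deleted = *-cancelˡ-≡ _ _ 2 (begin
    2 * ∣E∣ G                                 ≡⟨ vol≡2∣E∣ G ⟩
    total (A .adj)                            ≡⟨ total-minor₂ (A .adj) (A .sym-adj) (A .irrefl) q p′ apq ⟩
    2 * (d + count (A .adj p)) + vol G′       ≡⟨ cong₂ (λ u v → 2 * (d + u) + v) (count-cong rows) (sym (vol≡2∣E∣ G′)) ⟩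
    2 * (d + d) + 2 * ∣E∣ G′                  ≡⟨ ring d (∣E∣ G′) ⟩
    2 * (2 * d + ∣E∣ G′)                      ∎)
    where
    open ≡-Reasoning
    ring : ∀ d e → 2 * (d + d) + 2 * e ≡ 2 * (2 * d + e)
    ring = solve-∀

  -- Twins are non-adjacent and share their degree d, so exactly 2d edges disappear. This number is
  -- even, hence the ceiling falls by exactly d whatever the parity of m.
  threshold : ∀ k → 2 * (⌈ ∣E∣ G /2⌉ + k) ≡ 2 * d + 2 * (⌈ ∣E∣ G′ /2⌉ + k)
  threshold k = begin
    2 * (⌈ ∣E∣ G /2⌉ + k)             ≡⟨ cong (λ v → 2 * (⌈ v /2⌉ + k)) edges-deleted ⟩
    2 * (⌈ 2 * d + ∣E∣ G′ /2⌉ + k)    ≡⟨ cong (λ v → 2 * (v + k)) (⌈2d+m/2⌉ d (∣E∣ G′)) ⟩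
    2 * (d + ⌈ ∣E∣ G′ /2⌉ + k)        ≡⟨ ring d ⌈ ∣E∣ G′ /2⌉ k ⟩
    2 * d + 2 * (⌈ ∣E∣ G′ /2⌉ + k)    ∎
    where
    open ≡-Reasoning
    ring : ∀ d e k → 2 * (d + e + k) ≡ 2 * d + 2 * (e + k)
    ring = solve-∀

  module Separated (c : Fin (2 + n) → Bool) (sep : c q ≡ not (c p)) where

    -- Of the two edges from a common neighbour to the separated twins exactly one is cut, so d
    -- crossing edges are lost, the same amount as the threshold loses.
    cutVol-deleted : cutVol G c ≡ 2 * d + cutVol G′ (restrict c)
    cutVol-deleted = begin
      cutVol G c
        ≡⟨ total-minor₂ f (cut-sym {a = A .adj} c (A .sym-adj)) (cut-irrefl {a = A .adj} c (A .irrefl)) q p′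
            (cong (_∧ (c p xor c q)) apq) ⟩
      2 * (count (f q) + count (f p)) + cutVol G′ (restrict c)
        ≡⟨ cong (λ v → 2 * v + cutVol G′ (restrict c))
            (trans (sym (∑-distrib-+ {2 + n} (bit ∘ f q) (bit ∘ f p))) (sum-cong-≗ {2 + n} once)) ⟩
      2 * d + cutVol G′ (restrict c) ∎
      where
      open ≡-Reasoning
      f = cut (A .adj) c
      term : ∀ a u v → bit (a ∧ (not u xor v)) + bit (a ∧ (u xor v)) ≡ bit a
      term true  true  true  = refl
      term true  true  false = refl
      term true  false true  = refl
      term true  false false = refl
      term false u     v     = refl
      once : ∀ j → bit (f q j) + bit (f p j) ≡ bit (A .adj q j)
      once j = trans (cong₂ (λ u a → bit (A .adj q j ∧ (u xor c j)) + bit (a ∧ (c p xor c j))) sep (rows j))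
          (term (A .adj q j) (c p) (c j))

    count-deleted : ∀ (e : Fin (2 + n) → Bool) → e q ≡ not (e p) → count e ≡ suc (count (restrict e))
    count-deleted e sep′ = begin
      count e                                             ≡⟨ count-remove q e ⟩
      bit (e q) + count (e ∘ punchIn q)                   ≡⟨ cong (bit (e q) +_) (count-remove p′ (e ∘ punchIn q)) ⟩
      bit (e q) + (bit (e p) + count (restrict e))        ≡⟨ cong (λ v → bit v + (bit (e p) + count (restrict e))) sep′ ⟩
      bit (not (e p)) + (bit (e p) + count (restrict e))  ≡⟨ one (e p) ⟩
      suc (count (restrict e))                            ∎
      where
      open ≡-Reasoning
      one : ∀ b → bit (not b) + (bit b + count (restrict e)) ≡ suc (count (restrict e))
      one true  = refl
      one false = refl

    private
      c≡ = count-deleted c sep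
      c̄≡ = count-deleted (not ∘ c) (cong not sep)

    balanced-restrict : Balanced c → Balanced (restrict c)
    balanced-restrict b = record
      { lower = s≤s⁻¹ (subst₂ _≤_ c≡ c̄≡ (Balanced.lower b))
      ; upper = s≤s⁻¹ (subst₂ (λ u v → v ≤ u + 1) c≡ c̄≡ (Balanced.upper b)) }

    balanced-extend : Balanced (restrict c) → Balanced c
    balanced-extend b = record
      { lower = subst₂ _≤_ (sym c≡) (sym c̄≡) (s≤s (Balanced.lower b))
      ; upper = subst₂ (λ u v → v ≤ u + 1) (sym c≡) (sym c̄≡) (s≤s (Balanced.upper b)) }

  -- The twins return on opposite sides, one on each, so balance and the margin over the threshold
  -- are both kept.
  extend : ∀ {k} → Yes G′ k → Yes G k
  extend {k} (c′ , bal , cut≥) = c , balanced-extend (balanced-cong (sym ∘ c∘≗c′) bal) ,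
      subst₂ _≤_ (sym (threshold k)) (sym (trans cutVol-deleted (cong (2 * d +_) (cutVol-cong G′ c∘≗c′))))
          (+-monoʳ-≤ (2 * d) cut≥)
    where
    c₁ = insertAt c′ p′ true
    c : Fin (2 + n) → Bool
    c = insertAt c₁ q false
    sep : c q ≡ not (c p)
    sep = trans (insertAt-lookup c₁ q false)
        (cong not (sym (trans (insertAt-punchIn c₁ q false p′) (insertAt-lookup c′ p′ true))))
    c∘≗c′ : restrict c ≗ c′
    c∘≗c′ i = trans (insertAt-punchIn c₁ q false (punchIn p′ i)) (insertAt-punchIn c′ p′ true i)
    open Separated c sep

  restrict-separated : ∀ {k} c → c q ≡ not (c p) → Balanced c → 2 * (⌈ ∣E∣ G /2⌉ + k) ≤ cutVol G c → Yes G′ k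
  restrict-separated {k} c sep bal cut≥ = restrict c , balanced-restrict bal ,
      +-cancelˡ-≤ (2 * d) _ _ (subst₂ _≤_ (threshold k) cutVol-deleted cut≥)
    where open Separated c sep

  module Swap (z : Fin (2 + n)) (rows-z : ∀ j → A .adj z j ≡ A .adj q j) where

    π : Permutation (2 + n) (2 + n)
    π = transpose q z

    π-q : π ⟨$⟩ʳ q ≡ z
    π-q rewrite dec-true (q ≟ᶠ q) refl = refl

    π-fix : ∀ {i} → i ≢ q → i ≢ z → π ⟨$⟩ʳ i ≡ i
    π-fix {i} i≢q i≢z rewrite dec-false (i ≟ᶠ q) i≢q | dec-false (i ≟ᶠ z) i≢z = refl

    π-row : ∀ i j → A .adj (π ⟨$⟩ʳ i) j ≡ A .adj i j
    π-row i j with i ≟ᶠ q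
    ... | yes refl = rows-z j
    ... | no _ with i ≟ᶠ z
    ...   | yes refl = sym (rows-z j)
    ...   | no _     = refl

    -- Exchanging twins preserves rows, and by symmetry columns: it is an automorphism of the graph.
    π-adj : ∀ i j → A .adj (π ⟨$⟩ʳ i) (π ⟨$⟩ʳ j) ≡ A .adj i j
    π-adj i j = trans (π-row i _) (trans (A .sym-adj i _) (trans (π-row j i) (A .sym-adj j i)))

    count-π : ∀ (e : Fin (2 + n) → Bool) → count (e ∘ (π ⟨$⟩ʳ_)) ≡ count e
    count-π e = sym (sum-permute (bit ∘ e) π)

    balanced-π : ∀ {c} → Balanced c → Balanced (c ∘ (π ⟨$⟩ʳ_))
    balanced-π {c} b = record
      { lower = subst₂ _≤_ (sym (count-π c)) (sym (count-π (not ∘ c))) (Balanced.lower b)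
      ; upper = subst₂ (λ u v → v ≤ u + 1) (sym (count-π c)) (sym (count-π (not ∘ c))) (Balanced.upper b) }

    cutVol-π : ∀ c → cutVol G (c ∘ (π ⟨$⟩ʳ_)) ≡ cutVol G c
    cutVol-π c = sym (begin
      ∑[ i < 2 + n ] count (f i)                              ≡⟨ sum-permute (count ∘ f) π ⟩
      ∑[ i < 2 + n ] count (f (π ⟨$⟩ʳ i))                     ≡⟨ sum-cong-≗ {2 + n} (λ i → sym (count-π (f (π ⟨$⟩ʳ i)))) ⟩
      ∑[ i < 2 + n ] count (λ j → f (π ⟨$⟩ʳ i) (π ⟨$⟩ʳ j))
        ≡⟨ sum-cong-≗ {2 + n} (λ i → count-cong {2 + n} λ j → cong (_∧ (c (π ⟨$⟩ʳ i) xor c (π ⟨$⟩ʳ j))) (π-adj i j)) ⟩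
      cutVol G (c ∘ (π ⟨$⟩ʳ_))                                ∎)
      where
      open ≡-Reasoning
      f = cut (A .adj) c

  -- The set counted is the side of colour b.
  balanced⇒side≤ : ∀ c → Balanced c → ∀ b → 2 * count (λ i → not (b xor c i)) ≤ suc (2 + n)
  balanced⇒side≤ c bal b = cases b
    where
    N≡ = count-not c
    lower = Balanced.lower bal
    upper = Balanced.upper bal
    open ≤-Reasoning
    cases : ∀ b → 2 * count (λ i → not (b xor c i)) ≤ suc (2 + n)
    cases true = begin
      2 * count (not ∘ not ∘ c)     ≡⟨ cong (2 *_) (count-cong (not-involutive ∘ c)) ⟩
      2 * count c                   ≡⟨ cong (count c +_) (+-identityʳ _) ⟩
      count c + count c             ≤⟨ +-monoʳ-≤ (count c) lower ⟩
      count c + count (not ∘ c)     ≡⟨ N≡ ⟩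
      2 + n                         ≤⟨ n≤1+n _ ⟩
      suc (2 + n)                   ∎
    cases false = begin
      2 * count (not ∘ c)                 ≡⟨ cong (count (not ∘ c) +_) (+-identityʳ _) ⟩
      count (not ∘ c) + count (not ∘ c)   ≤⟨ +-monoˡ-≤ (count (not ∘ c)) upper ⟩
      count c + 1 + count (not ∘ c)       ≡⟨ cong (_+ count (not ∘ c)) (+-comm (count c) 1) ⟩
      suc (count c + count (not ∘ c))     ≡⟨ cong suc N≡ ⟩
      suc (2 + n)                         ∎

  -- If p and q are on the same side, a majority class has a third twin z on the
  -- other side, and exchanging q and z does not change the cut.
  contract : ∀ {k} → suc (2 + n) < 2 * count (twin G q) → Yes G k → Yes G′ k
  contract {k} maj (c , bal , cut≥) = cases (c q Bool.≟ not (c p))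
      (any? λ z → (twin G q z Bool.≟ true) ×-dec (c z Bool.≟ not (c p)))
    where
    cases : Dec (c q ≡ not (c p)) → Dec (∃[ z ] twin G q z ≡ true × c z ≡ not (c p)) → Yes G′ k
    cases (yes sep) _ = restrict-separated {k} c sep bal cut≥
    cases (no _) (yes (z , tz , cz)) = restrict-separated {k} (c ∘ (π ⟨$⟩ʳ_)) sep (balanced-π bal)
        (≤-trans cut≥ (≤-reflexive (sym (cutVol-π c))))
      where
      open Swap z (λ j → sym (twin⇒≡ G tz j))
      p≢z : p ≢ z
      p≢z p≡z = Bool.not-¬ refl (trans (cong c p≡z) cz)
      sep : c (π ⟨$⟩ʳ q) ≡ not (c (π ⟨$⟩ʳ p))
      sep = trans (cong c π-q) (trans cz (cong (not ∘ c) (sym (π-fix (punchInᵢ≢i q p′) p≢z))))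
    -- With no twin on the other side, the whole class of q lies on the side of p, which is too
    -- small for it.
    cases (no _) (no none) = contradiction
        (≤-trans (*-monoʳ-≤ 2 (count-mono {p = twin G q} {q = λ i → not (c p xor c i)} same))
        (balanced⇒side≤ c bal (c p))) (<⇒≱ maj)
      where
      agree : ∀ u v → v ≢ not u → not (u xor v) ≡ true
      agree true  true  _ = refl
      agree true  false h = contradiction refl h
      agree false true  h = contradiction refl h
      agree false false _ = refl
      same : ∀ i → twin G q i ≡ true → not (c p xor c i) ≡ true
      same i ti = agree (c p) (c i) λ ci → none (i , ti , ci)

  delete-twins : suc (2 + n) < 2 * count (twin G q) → ∀ k → Yes G k ⇔ Yes G′ k
  delete-twins maj k = mk⇔ (contract {k} maj) (extend {k})

-- Time bounds, frames and total correctness for programs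

≢⇒≡ᵇ-false : ∀ m n → m ≢ n → (m ≡ᵇ n) ≡ false
≢⇒≡ᵇ-false m n m≢n with m ≡ᵇ n in eq
... | false = refl
... | true  = contradiction (≡ᵇ⇒≡ m n (subst T (sym eq) tt)) m≢n

≡ᵇ-refl : ∀ m → (m ≡ᵇ m) ≡ true
≡ᵇ-refl zero    = refl
≡ᵇ-refl (suc m) = ≡ᵇ-refl m

update-same : ∀ f a v → update f a v a ≡ v
update-same f a v rewrite ≡ᵇ-refl a = refl

update-other : ∀ f {a b} v → a ≢ b → update f a v b ≡ f b
update-other f {a} {b} v a≢b rewrite ≢⇒≡ᵇ-false a b a≢b = refl

-- An upper bound on the running time, valid when no loop makes more than L iterations per entry.
time : ℕ → Program → ℕ
time L skip           = 1
time L (r ≔ e)        = 1 + cost e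
time L (store e ≔ e′) = 1 + cost e + cost e′
time L (P ⨾ Q)        = time L P + time L Q
time L (cond e P Q)   = 1 + cost e + (time L P + time L Q)
time L (while e P)    = L * (1 + cost e + time L P) + (1 + cost e)

-- Only positive arguments are bounded, since there powers grow with the exponent and terms of
-- different degrees can be merged.
record PolyBounded (f : ℕ → ℕ) : Set where
  constructor poly
  field
    coefficient degree : ℕ
    bounded            : ∀ l → f (suc l) ≤ coefficient * suc l ^ degree

poly-const : ∀ c → PolyBounded (λ _ → c)
poly-const c = poly c 0 λ l → ≤-reflexive (sym (*-identityʳ c))

poly-+ : ∀ {f g} → PolyBounded f → PolyBounded g → PolyBounded (λ L → f L + g L)
poly-+ {f} {g} (poly a b f≤) (poly a′ b′ g≤) = poly (a + a′) (b + b′) λ l → begin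
  f (suc l) + g (suc l)                                    ≤⟨ +-mono-≤ (f≤ l) (g≤ l) ⟩
  a * suc l ^ b + a′ * suc l ^ b′
    ≤⟨ +-mono-≤ (*-monoʳ-≤ a (^-monoʳ-≤ (suc l) (m≤m+n b b′))) (*-monoʳ-≤ a′ (^-monoʳ-≤ (suc l) (m≤n+m b′ b))) ⟩
  a * suc l ^ (b + b′) + a′ * suc l ^ (b + b′)             ≡⟨ *-distribʳ-+ (suc l ^ (b + b′)) a a′ ⟨
  (a + a′) * suc l ^ (b + b′)                              ∎
  where open ≤-Reasoning

poly-L* : ∀ {f} → PolyBounded f → PolyBounded (λ L → L * f L)
poly-L* {f} (poly a b f≤) = poly a (suc b) λ l → begin
  suc l * f (suc l)          ≤⟨ *-monoʳ-≤ (suc l) (f≤ l) ⟩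
  suc l * (a * suc l ^ b)    ≡⟨ ring (suc l) a (suc l ^ b) ⟩
  a * (suc l * suc l ^ b)    ∎
  where
  open ≤-Reasoning
  ring : ∀ x a y → x * (a * y) ≡ a * (x * y)
  ring = solve-∀

time-poly : ∀ P → PolyBounded (λ L → time L P)
time-poly skip           = poly-const 1
time-poly (r ≔ e)        = poly-const (1 + cost e)
time-poly (store e ≔ e′) = poly-const (1 + cost e + cost e′)
time-poly (P ⨾ Q)        = poly-+ (time-poly P) (time-poly Q)
time-poly (cond e P Q)   = poly-+ (poly-const (1 + cost e)) (poly-+ (time-poly P) (time-poly Q))
time-poly (while e P)    = poly-+ (poly-L* (poly-+ (poly-const (1 + cost e)) (time-poly P))) (poly-const (1 + cost e))

-- `writes` and `stores` are computable footprints: for a concrete program the side conditions of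
-- `Frame` reduce and are proved by `refl`.
writes : Program → ℕ → Bool
writes skip           s = false
writes (r ≔ e)        s = r ≡ᵇ s
writes (store e ≔ e′) s = false
writes (P ⨾ Q)        s = writes P s ∨ writes Q s
writes (cond e P Q)   s = writes P s ∨ writes Q s
writes (while e P)    s = writes P s

stores : Program → Bool
stores skip           = false
stores (r ≔ e)        = false
stores (store e ≔ e′) = true
stores (P ⨾ Q)        = stores P ∨ stores Q
stores (cond e P Q)   = stores P ∨ stores Q
stores (while e P)    = stores P

∨-false : ∀ {a b} → a ∨ b ≡ false → a ≡ false × b ≡ false
∨-false {false} {false} _ = refl , refl

record Frame (P : Program) (σ σ′ : State) : Set where
  field
    regs : ∀ r → writes P r ≡ false → reg σ′ r ≡ reg σ r
    mems : stores P ≡ false → ∀ a → mem σ′ a ≡ mem σ a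

open Frame public

frame-refl : ∀ {P σ} → Frame P σ σ
frame-refl = record { regs = λ _ _ → refl ; mems = λ _ _ → refl }

frame-trans : ∀ {P σ σ′ σ″} → Frame P σ σ′ → Frame P σ′ σ″ → Frame P σ σ″
frame-trans f g = record
  { regs = λ r w → trans (g .regs r w) (f .regs r w) ; mems = λ s a → trans (g .mems s a) (f .mems s a) }

frame-weaken : ∀ {P Q σ σ′} → (∀ r → writes Q r ≡ false → writes P r ≡ false) →
               (stores Q ≡ false → stores P ≡ false) → Frame P σ σ′ → Frame Q σ σ′
frame-weaken w s f = record { regs = λ r → f .regs r ∘ w r ; mems = f .mems ∘ s }

frame : ∀ {P σ σ′ t} → ⟨ P , σ ⟩⇓⟨ σ′ , t ⟩ → Frame P σ σ′
frame ⇓skip = frame-refl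
frame {r ≔ e} {σ} ⇓assign = record
  { regs = λ s w → regs′ s w ; mems = λ _ _ → refl }
  where
  regs′ : ∀ s → (r ≡ᵇ s) ≡ false → update (reg σ) r (⟦ e ⟧ σ) s ≡ reg σ s
  regs′ s w rewrite w = refl
frame ⇓store = record { regs = λ _ _ → refl ; mems = λ () }
frame (⇓seq d d′) = frame-trans
  (frame-weaken (λ r → proj₁ ∘ ∨-false) (proj₁ ∘ ∨-false) (frame d))
  (frame-weaken (λ r → proj₂ ∘ ∨-false) (proj₂ ∘ ∨-false) (frame d′))
frame (⇓cond-true _ d)  = frame-weaken (λ r → proj₁ ∘ ∨-false) (proj₁ ∘ ∨-false) (frame d)
frame {cond e P Q} (⇓cond-false _ d) = frame-weaken (λ r → proj₂ ∘ ∨-false {writes P r}) (proj₂ ∘ ∨-false {stores P})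
    (frame d)
frame (⇓while-true _ d d′) = frame-trans (frame-weaken (λ _ w → w) (λ s → s) (frame d)) (frame d′)
frame (⇓while-false _) = frame-refl

-- Truncated subtraction makes the test nonzero exactly while the counter is below the bound.
for : ℕ → ℕ → Program → Program
for r b P = r ≔ const 0 ⨾ while (var b ⊖ var r) (P ⨾ r ≔ var r ⊕ const 1)

module Hoare (L : ℕ) where

  -- Total correctness with time measured against the syntactic bound `time L P`, so that
  -- specifications never mention running times.
  record Runs (P : Program) (σ : State) (Φ : State → Set) : Set where
    constructor runs
    field
      {final} : State
      {steps} : ℕ
      evals   : ⟨ P , σ ⟩⇓⟨ final , steps ⟩
      timely  : steps ≤ time L P
      post    : Φ final

  open Runs public

  run-skip : ∀ {σ} {Φ : State → Set} → Φ σ → Runs skip σ Φ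
  run-skip φ = runs ⇓skip ≤-refl φ

  run-assign : ∀ {σ r e} {Φ : State → Set} → Φ (setReg r (⟦ e ⟧ σ) σ) → Runs (r ≔ e) σ Φ
  run-assign φ = runs ⇓assign ≤-refl φ

  run-store : ∀ {σ e e′} {Φ : State → Set} → Φ (setMem (⟦ e ⟧ σ) (⟦ e′ ⟧ σ) σ) → Runs (store e ≔ e′) σ Φ
  run-store φ = runs ⇓store ≤-refl φ

  run-seq : ∀ {P Q σ} {Φ : State → Set} → Runs P σ (λ σ′ → Runs Q σ′ Φ) → Runs (P ⨾ Q) σ Φ
  run-seq (runs d t (runs d′ t′ φ)) = runs (⇓seq d d′) (+-mono-≤ t t′) φ

  -- The continuation also receives the frame of `P`, from which everything about untouched
  -- registers and memory is recovered.
  run-then : ∀ {P Q σ} {Φ Ψ : State → Set} → Runs P σ Φ → (∀ σ′ → Frame P σ σ′ → Φ σ′ → Runs Q σ′ Ψ) → Runs (P ⨾ Q) σ Ψ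
  run-then (runs d t φ) k = run-seq (runs d t (k _ (frame d) φ))

  run-assign⨾ : ∀ {σ r e Q} {Φ : State → Set} → Runs Q (setReg r (⟦ e ⟧ σ) σ) Φ → Runs (r ≔ e ⨾ Q) σ Φ
  run-assign⨾ = run-seq ∘ run-assign

  run-weaken : ∀ {P σ} {Φ Ψ : State → Set} → (∀ σ′ → Frame P σ σ′ → Φ σ′ → Ψ σ′) → Runs P σ Φ → Runs P σ Ψ
  run-weaken h (runs d t φ) = runs d t (h _ (frame d) φ)

  run-cond : ∀ {e P Q σ} {Φ : State → Set} → (⟦ e ⟧ σ ≢ 0 → Runs P σ Φ) → (⟦ e ⟧ σ ≡ 0 → Runs Q σ Φ) → Runs (cond e P Q) σ Φ
  run-cond {e} {P} {Q} {σ} p q with ⟦ e ⟧ σ ≟ 0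
  ... | yes z with q z
  ...   | runs d t φ = runs (⇓cond-false z d) (+-monoʳ-≤ (1 + cost e) (≤-trans t (m≤n+m _ _))) φ
  run-cond {e} {P} {Q} {σ} p q | no nz with p nz
  ...   | runs d t φ = runs (⇓cond-true nz d) (+-monoʳ-≤ (1 + cost e) (≤-trans t (m≤m+n _ _))) φ

  private
    loop-time : ∀ {c s t T m} → s ≤ T → t ≤ m * (c + T) + c → c + s + t ≤ suc m * (c + T) + c
    loop-time {c} {s} {t} {T} {m} s≤ t≤ = ≤-trans (+-mono-≤ (+-monoʳ-≤ c s≤) t≤)
        (≤-reflexive (sym (+-assoc (c + T) (m * (c + T)) c)))

  -- The index of `Inv` is a strictly decreasing variant; starting at most at L, it also bounds the
  -- number of iterations.
  run-while : ∀ {e P} (Inv : ℕ → State → Set) →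
    (∀ m σ → ⟦ e ⟧ σ ≢ 0 → Inv m σ → Runs P σ (λ σ′ → ∃[ m′ ] m′ < m × Inv m′ σ′)) →
    ∀ {m σ} → m ≤ L → Inv m σ → Runs (while e P) σ (λ σ′ → ⟦ e ⟧ σ′ ≡ 0 × ∃[ m′ ] Inv m′ σ′)
  run-while {e} {P} Inv body {m} {σ} m≤L inv with go m m σ ≤-refl inv
    where
    -- The variant may drop by more than one, so recursion is on separate fuel.
    go : ∀ fuel m σ → m ≤ fuel → Inv m σ → ∃[ σ′ ] ∃[ t ] ⟨ while e P , σ ⟩⇓⟨ σ′ , t ⟩ ×
         t ≤ fuel * (1 + cost e + time L P) + (1 + cost e) × ⟦ e ⟧ σ′ ≡ 0 × ∃[ m′ ] Inv m′ σ′
    go fuel m σ m≤ inv with ⟦ e ⟧ σ ≟ 0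
    ... | yes z = σ , _ , ⇓while-false z , m≤n+m _ _ , z , m , inv
    go fuel m σ m≤ inv | no nz with body m σ nz inv
    go zero m σ m≤ inv | no nz | runs d t (m′ , m′<m , inv′) = contradiction (≤-trans m′<m m≤) λ ()
    go (suc fuel) m σ m≤ inv | no nz | runs d t (m′ , m′<m , inv′) with go fuel m′ _ (s≤s⁻¹ (≤-trans m′<m m≤)) inv′
    ... | σ″ , t″ , d″ , t≤ , φ = σ″ , _ , ⇓while-true nz d d″ , loop-time {1 + cost e} {m = fuel} t t≤ , φ
  ... | σ′ , t , d , t≤ , φ = runs d (≤-trans t≤ (+-monoˡ-≤ (1 + cost e) (*-monoˡ-≤ (1 + cost e + time L P) m≤L))) φ

  -- The obligation on the body refers to the state after the counter has been incremented. The
  -- frame relative to `σ₀` is accumulated over the iterations, which keeps facts about untouched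
  -- registers out of `Inv`.
  run-for : ∀ {r b P σ₀ N} (Inv : ℕ → State → Set) →
    writes P r ≡ false → writes (for r b P) b ≡ false → reg σ₀ b ≡ N → N ≤ L →
    Inv 0 (setReg r 0 σ₀) →
    (∀ (i : Fin N) σ → reg σ r ≡ toℕ i → Frame (for r b P) σ₀ σ → Inv (toℕ i) σ →
       Runs P σ (λ σ′ → Inv (suc (toℕ i)) (setReg r (suc (toℕ i)) σ′))) →
    Runs (for r b P) σ₀ (Inv N)
  run-for {r} {b} {P} {σ₀} {N} Inv Pr Wb bN N≤L inv₀ body =
    finish (go N 0 (setReg r 0 σ₀) (+-identityʳ N) (update-same (reg σ₀) r 0) frame₀ inv₀)
    where
    W = for r b P
    B = P ⨾ r ≔ var r ⊕ const 1
    c = 1 + cost (var b ⊖ var r)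
    frame₀ : Frame W σ₀ (setReg r 0 σ₀)
    frame₀ = frame-weaken {Q = W} (λ s → proj₁ ∘ ∨-false) (λ _ → refl) (frame (⇓assign {σ₀} {r} {const 0}))
    go : ∀ m i σ → m + i ≡ N → reg σ r ≡ i → Frame W σ₀ σ → Inv i σ →
         ∃[ σ′ ] ∃[ t ] ⟨ while (var b ⊖ var r) B , σ ⟩⇓⟨ σ′ , t ⟩ × t ≤ m * (c + time L B) + c × Inv N σ′
    go zero i σ refl ri F inv = σ , c , ⇓while-false
        (trans (cong₂ _∸_ (trans (F .regs b Wb) bN) ri) (n∸n≡0 i)) , ≤-refl , inv
    go (suc m) i σ m+i≡N ri F inv = iterate
        (body (fromℕ< i<N) σ (trans ri (sym (toℕ-fromℕ< i<N))) F (subst (λ j → Inv j σ) (sym (toℕ-fromℕ< i<N)) inv))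
      where
      i<N : i < N
      i<N = subst (suc i ≤_) m+i≡N (s≤s (m≤n+m i m))
      nz : reg σ b ∸ reg σ r ≢ 0
      nz eq = m>n⇒m∸n≢0 i<N (trans (sym (cong₂ _∸_ (trans (F .regs b Wb) bN) ri)) eq)
      iterate : Runs P σ (λ σ′ → Inv (suc (toℕ (fromℕ< i<N))) (setReg r (suc (toℕ (fromℕ< i<N))) σ′)) → _
      iterate (runs {σ′} {s} d t inv′) = advance
          (go m (suc i) σ₁ (trans (+-suc m i) m+i≡N) (trans (update-same (reg σ′) r _) r+1) F₁ inv₁)
        where
        σ₁ = setReg r (reg σ′ r + 1) σ′
        dB : ⟨ B , σ ⟩⇓⟨ σ₁ , s + (1 + cost (var r ⊕ const 1)) ⟩
        dB = ⇓seq d ⇓assign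
        r+1 : reg σ′ r + 1 ≡ suc i
        r+1 = trans (cong (_+ 1) (trans (frame d .regs r Pr) ri)) (+-comm i 1)
        inv₁ : Inv (suc i) σ₁
        inv₁ = subst₂ (λ j v → Inv j (setReg r v σ′)) (cong suc (toℕ-fromℕ< i<N))
            (trans (cong suc (toℕ-fromℕ< i<N)) (sym r+1)) inv′
        F₁ : Frame W σ₀ σ₁
        F₁ = frame-trans F (frame-weaken {Q = W} (λ q → proj₂ ∘ ∨-false {r ≡ᵇ q}) (λ x → x) (frame dB))
        advance : _ → _
        -- 4 is the time of the increment.
        advance (σ″ , t″ , d″ , t≤ , φ) = σ″ , _ , ⇓while-true nz dB d″ , loop-time {c} {T = time L B} {m = m}
            (+-monoˡ-≤ 4 t) t≤ , φ
    finish : _ → Runs W σ₀ (Inv N)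
    -- 2 is the time of resetting the counter.
    finish (σ′ , t , d , t≤ , φ) = runs (⇓seq ⇓assign d)
        (+-monoʳ-≤ 2 (≤-trans t≤ (+-monoˡ-≤ c (*-monoˡ-≤ (c + time L B) N≤L)))) φ

-- The bound is a natural number so that a loop counter, including its final value n, can be
-- substituted for it.
prefixSum : ∀ {n} → (Fin n → ℕ) → ℕ → ℕ
prefixSum {zero}  f w       = 0
prefixSum {suc n} f zero    = 0
prefixSum {suc n} f (suc w) = f zero + prefixSum (f ∘ suc) w

prefixSum-zero : ∀ {n} (f : Fin n → ℕ) → prefixSum f 0 ≡ 0
prefixSum-zero {zero}  f = refl
prefixSum-zero {suc n} f = refl

prefixSum-suc : ∀ {n} (f : Fin n → ℕ) i → prefixSum f (suc (toℕ i)) ≡ prefixSum f (toℕ i) + f i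
prefixSum-suc {suc n} f zero    = trans (cong (f zero +_) (prefixSum-zero (f ∘ suc))) (+-identityʳ (f zero))
prefixSum-suc {suc n} f (suc i) = trans (cong (f zero +_) (prefixSum-suc (f ∘ suc) i)) (sym (+-assoc (f zero) _ _))

prefixSum-full : ∀ {n} (f : Fin n → ℕ) → prefixSum f n ≡ sum f
prefixSum-full {zero}  f = refl
prefixSum-full {suc n} f = cong (f zero +_) (prefixSum-full (f ∘ suc))

-- 1 ∸ (x ∸ i) is the indicator of x ≤ i, so the shift past a deleted index is an expression the
-- machine can evaluate.
toℕ-punchIn : ∀ {n} (x : Fin (suc n)) (i : Fin n) → toℕ (punchIn x i) ≡ toℕ i + (1 ∸ (toℕ x ∸ toℕ i))
toℕ-punchIn zero    i       = trans (+-comm 1 (toℕ i)) (cong (λ v → toℕ i + (1 ∸ v)) (sym (0∸n≡0 (toℕ i))))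
toℕ-punchIn (suc x) zero    = sym (0∸n≡0 (toℕ x))
toℕ-punchIn (suc x) (suc i) = cong suc (toℕ-punchIn x i)

-- Program

rK rN rFound rV rVRow rW rWRow rJ rDiff rCount rPrev rLast rP rQ rX rM rI rSrc rDst rRow rSq rKN rSum : ℕ
rK     = 0
rN     = 1
rFound = 2
rV     = 3
rVRow  = 4
rW     = 5
rWRow  = 6
rJ     = 7
rDiff  = 8
rCount = 9
rPrev  = 10
rLast  = 11
rP     = 12
rQ     = 13
rX     = 14
rM     = 15
rI     = 16
rSrc   = 17
rDst   = 18
rRow   = 19
rSq    = 20
rKN    = 21
rSum   = 22

-- Adding the truncated differences in both directions gives |x - y|, so `rDiff` stays zero exactly
-- when the rows agree.
compareRows : Program
compareRows =
  rDiff ≔ const 0 ⨾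
  for rJ rN
    (rDiff ≔ var rDiff ⊕ (entry rVRow ⊖ entry rWRow) ⊕ (entry rWRow ⊖ entry rVRow))
  where
  entry : ℕ → Expr
  entry row = load (var row ⊕ var rJ)

-- The last two twins seen are kept in `rPrev` and `rLast`; they become the pair to delete.
countTwins : Program
countTwins =
  rCount ≔ const 0 ⨾
  rWRow ≔ const 0 ⨾
  for rW rN
    (compareRows ⨾
     cond (var rDiff)
       skip
       (rPrev ≔ var rLast ⨾ rLast ≔ var rW ⨾ rCount ≔ var rCount ⊕ const 1) ⨾
     rWRow ≔ var rWRow ⊕ var rN)

findMajority : Program
findMajority =
  rFound ≔ const 0 ⨾
  rVRow ≔ const 0 ⨾
  for rV rN
    (countTwins ⨾
     cond ((var rCount ⊕ var rCount) ⊖ (var rN ⊕ const 1))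
       (rFound ≔ const 1 ⨾ rP ≔ var rPrev ⨾ rQ ≔ var rLast)
       skip ⨾
     rVRow ≔ var rVRow ⊕ var rN)

-- Compacts the matrix in place; rDst never overtakes the entry being read.
deleteVertex : Program
deleteVertex =
  rM ≔ var rN ⊖ const 1 ⨾
  rSrc ≔ const 0 ⨾
  rDst ≔ const 0 ⨾
  for rI rM
    (cond (var rX ⊖ var rI) (rRow ≔ var rSrc) (rRow ≔ var rSrc ⊕ var rN) ⨾
     for rJ rM
       ((store (var rDst) ≔ load (var rRow ⊕ (var rJ ⊕ (const 1 ⊖ (var rX ⊖ var rJ))))) ⨾
        rDst ≔ var rDst ⊕ const 1) ⨾
     rSrc ≔ var rSrc ⊕ var rN) ⨾
  rN ≔ var rM

-- The larger index `rQ` goes first, so that `rP` is still a correct index afterwards.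
deletePair : Program
deletePair = rX ≔ var rQ ⨾ deleteVertex ⨾ rX ≔ var rP ⨾ deleteVertex

reduce : Program
reduce =
  rFound ≔ const 1 ⨾
  while (var rFound)
    (findMajority ⨾ cond (var rFound) deletePair skip)

-- rSq = k · min(k , n), so that the loop is polynomial even when k is exponentially large.
squareParameter : Program
squareParameter =
  rSq ≔ const 0 ⨾
  for rI rN (cond (var rK ⊖ var rI) (rSq ≔ var rSq ⊕ var rK) skip)

scaleParameter : Program
scaleParameter =
  rKN ≔ const 0 ⨾
  for rI rN (rKN ≔ var rKN ⊕ var rK)

sumMatrix : Program
sumMatrix =
  rSum ≔ const 0 ⨾
  rRow ≔ const 0 ⨾
  for rI rN
    (for rJ rN (rSum ≔ var rSum ⊕ load (var rRow ⊕ var rJ)) ⨾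
     rRow ≔ var rRow ⊕ var rN)

double : Expr → Expr
double e = e ⊕ e

-- A sum of truncated differences is nonzero iff one of the bounds 32·`rSq` + 1 on the order and
-- 8·`rKN` on the matrix sum is exceeded.
answerIfLarge : Program
answerIfLarge =
  cond ((var rN ⊖ (double (double (double (double (double (var rSq))))) ⊕ const 1)) ⊕
        (var rSum ⊖ double (double (double (var rKN)))))
    (rK ≔ const 0 ⨾ rN ≔ const 0)
    skip

kernelize : Program
kernelize = reduce ⨾ squareParameter ⨾ scaleParameter ⨾ sumMatrix ⨾ answerIfLarge

-- Correctness of the program

open Adjacency

Rep : ∀ {n} → State → ℕ → Adjacency n → Set
Rep σ k A = Represents σ (graph A ,, k)

module _ {n} {A : Adjacency n} {k : ℕ} where

  rep-transport : ∀ {σ σ′} → reg σ′ rK ≡ reg σ rK → reg σ′ rN ≡ reg σ rN → (∀ a → mem σ′ a ≡ mem σ a) →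
                  Rep σ k A → Rep σ′ k A
  rep-transport K≡ N≡ mem≡ R = record
    { parameter-reg = trans K≡ (Represents.parameter-reg R)
    ; order-reg     = trans N≡ (Represents.order-reg R)
    ; adj-mem       = λ i j → trans (mem≡ _) (Represents.adj-mem R i j) }

  read : ∀ {σ a b} → Rep σ k A → ∀ i j → a ≡ n * toℕ i → b ≡ toℕ j → mem σ (a + b) ≡ bit (A .adj i j)
  read {σ} R i j a≡ b≡ = trans (cong (mem σ) (trans (cong₂ _+_ a≡ b≡) (sym (toℕ-combine i j)))) (Represents.adj-mem R i j)

next-row : ∀ n {i a b} → a ≡ n * i → b ≡ n → a + b ≡ n * suc i
next-row n {i} a≡ b≡ = trans (cong₂ _+_ a≡ b≡) (trans (+-comm (n * i) n) (sym (*-suc n i)))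

<-suc-cases : ∀ {m n} {P : Set} → m < suc n → (m < n → P) → (m ≡ n → P) → P
<-suc-cases m<1+n lt eq = case m≤n⇒m<n∨m≡n (s≤s⁻¹ m<1+n) of λ where
  (inj₁ m<n) → lt m<n
  (inj₂ m≡n) → eq m≡n

-- 132 comes from the edges: 4k·(32k² + 1) = 128k³ + 4k ≤ 132k³. The bound 32k² + 1 on the order
-- fits below it.
record IsKernel (G : Graph) (k : ℕ) (I : Instance) : Set where
  open Instance I renaming (graph to G′; parameter to k′)
  field
    equiv : Yes G k ⇔ Yes G′ k′
    k′≤k  : k′ ≤ k
    V≤    : ∣V∣ G′ ≤ 132 * (k ^ 2 + 1)
    E≤    : ∣E∣ G′ ≤ 132 * (k ^ 3 + 1)

module Correctness (L : ℕ) where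

  open Hoare L

  -- Searching for a majority class of twins

  module Search {n} (A : Adjacency n) (k : ℕ) (n≤L : n ≤ L) where

    private
      G = graph A
      a = A .adj

    compareRows-spec : ∀ {σ} v w → Rep σ k A → reg σ rVRow ≡ n * toℕ v → reg σ rWRow ≡ n * toℕ w →
      Runs compareRows σ (λ σ′ → (reg σ′ rDiff ≡ 0 → ∀ j → a v j ≡ a w j) ×
                                 ((∀ j → a v j ≡ a w j) → reg σ′ rDiff ≡ 0))
    compareRows-spec {σ} v w R v≡ w≡ = run-assign⨾ (run-weaken
        (λ σ′ _ (f , g) → (λ d≡0 j → f d≡0 j (toℕ<n j)) , g)
        (run-for Inv refl refl (Represents.order-reg R) n≤L ((λ _ j ()) , λ _ → refl) step))
      where
      Inv : ℕ → State → Set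
      Inv i σ′ = (reg σ′ rDiff ≡ 0 → ∀ j → toℕ j < i → a v j ≡ a w j) ×
                 ((∀ j → a v j ≡ a w j) → reg σ′ rDiff ≡ 0)
      step : ∀ (i : Fin n) σ₁ → reg σ₁ rJ ≡ toℕ i → Frame _ (setReg rDiff 0 σ) σ₁ → Inv (toℕ i) σ₁ → Runs _ σ₁ _
      step i σ₁ j≡ F (f , g) = run-assign (f′ , g′)
        where
        R₁ : Rep σ₁ k A
        R₁ = rep-transport (F .regs rK refl) (F .regs rN refl) (F .mems refl) R
        x = mem σ₁ (reg σ₁ rVRow + reg σ₁ rJ)
        y = mem σ₁ (reg σ₁ rWRow + reg σ₁ rJ)
        x≡ : x ≡ bit (a v i)
        x≡ = read R₁ v i (trans (F .regs rVRow refl) v≡) j≡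
        y≡ : y ≡ bit (a w i)
        y≡ = read R₁ w i (trans (F .regs rWRow refl) w≡) j≡
        f′ : reg σ₁ rDiff + (x ∸ y) + (y ∸ x) ≡ 0 → ∀ j → toℕ j < suc (toℕ i) → a v j ≡ a w j
        f′ e j j<1+i = <-suc-cases j<1+i (f (m+n≡0⇒m≡0 _ e₁) j) λ j≡i → subst (λ l → a v l ≡ a w l) (sym (toℕ-injective j≡i))
            (bit-injective (trans (sym x≡) (trans
                (≤-antisym (m∸n≡0⇒m≤n (m+n≡0⇒n≡0 (reg σ₁ rDiff) e₁))
                (m∸n≡0⇒m≤n (m+n≡0⇒n≡0 (reg σ₁ rDiff + (x ∸ y)) e))) y≡)))
          where e₁ = m+n≡0⇒m≡0 (reg σ₁ rDiff + (x ∸ y)) e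
        g′ : (∀ j → a v j ≡ a w j) → reg σ₁ rDiff + (x ∸ y) + (y ∸ x) ≡ 0
        g′ rows = cong₂ _+_ (cong₂ _+_ (g rows) (m≤n⇒m∸n≡0 (≤-reflexive x≡y))) (m≤n⇒m∸n≡0 (≤-reflexive (sym x≡y)))
          where
          x≡y : x ≡ y
          x≡y = trans x≡ (trans (cong bit (rows i)) (sym y≡))

    -- `p<q` reflects the order of discovery and is what later justifies the order of the two
    -- deletions.
    record Twins< (v : Fin n) (b : ℕ) (σ : State) : Set where
      field
        p q    : Fin n
        p<q    : toℕ p < toℕ q
        q<     : toℕ q < b
        twin-p : twin G v p ≡ true
        twin-q : twin G v q ≡ true
        prev≡  : reg σ rPrev ≡ toℕ p
        last≡  : reg σ rLast ≡ toℕ q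

    twins<-transport : ∀ {v b b′ σ σ′} → b ≤ b′ → reg σ′ rPrev ≡ reg σ rPrev → reg σ′ rLast ≡ reg σ rLast →
                       Twins< v b σ → Twins< v b′ σ′
    twins<-transport b≤b′ prev last t = record
      { p = p ; q = q ; p<q = p<q ; q< = ≤-trans q< b≤b′ ; twin-p = twin-p ; twin-q = twin-q
      ; prev≡ = trans prev prev≡ ; last≡ = trans last last≡ }
      where open Twins< t

    countTwins-spec : ∀ {σ} v → Rep σ k A → reg σ rVRow ≡ n * toℕ v →
      Runs countTwins σ (λ σ′ → reg σ′ rCount ≡ count (twin G v) × (2 ≤ reg σ′ rCount → Twins< v n σ′))
    countTwins-spec {σ} v R v≡ = run-assign⨾ (run-assign⨾ (run-weaken
        (λ σ′ _ I → trans (count≡ I) (prefixSum-full (bit ∘ twin G v)) , two I)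
        (run-for Inv refl refl (Represents.order-reg R) n≤L
          (record { row≡ = sym (*-zeroʳ n) ; count≡ = sym (prefixSum-zero (bit ∘ twin G v)) ; one = λ () ; two = λ () })
          step)))
      where
      -- `rLast` is meaningful only after one twin has been found and `rPrev` only after two, hence
      -- the guards on `one` and `two`.
      record Inv (i : ℕ) (σ′ : State) : Set where
        field
          row≡   : reg σ′ rWRow ≡ n * i
          count≡ : reg σ′ rCount ≡ prefixSum (bit ∘ twin G v) i
          one    : 1 ≤ reg σ′ rCount → ∃[ l ] toℕ l < i × twin G v l ≡ true × reg σ′ rLast ≡ toℕ l
          two    : 2 ≤ reg σ′ rCount → Twins< v i σ′
      open Inv
      σ₀ = setReg rWRow 0 (setReg rCount 0 σ)
      step : ∀ (i : Fin n) σ₁ → reg σ₁ rW ≡ toℕ i → Frame _ σ₀ σ₁ → Inv (toℕ i) σ₁ → Runs _ σ₁ _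
      step i σ₁ w≡ F I = run-then (compareRows-spec v i R₁ (trans (F .regs rVRow refl) v≡) (row≡ I)) λ σ₂ F₂ (f , g) →
          let
            row₂ : reg σ₂ rWRow + reg σ₂ rN ≡ n * suc (toℕ i)
            row₂ = next-row n (trans (F₂ .regs rWRow refl) (row≡ I)) (trans (F₂ .regs rN refl) (Represents.order-reg R₁))
            c₂ = F₂ .regs rCount refl
            last₂ = F₂ .regs rLast refl
            prev₂ = F₂ .regs rPrev refl
          in
          run-seq (run-cond
            (λ d≢0 → run-skip (run-assign (record
              { row≡ = row₂
              ; count≡ = trans (trans c₂ (count≡ I)) (sym (trans (prefixSum-suc (bit ∘ twin G v) i)
                  (trans (cong (λ b → prefixSum (bit ∘ twin G v) (toℕ i) + bit b)
                      (Bool.¬-not λ t → d≢0 (g (twin⇒≡ G t)))) (+-identityʳ _))))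
              ; one = λ le → let l , l< , tl , ll = one I (≤-trans le (≤-reflexive c₂)) in l , m<n⇒m<1+n l< , tl , trans last₂ ll
              ; two = λ le → twins<-transport (n≤1+n _) prev₂ last₂ (two I (≤-trans le (≤-reflexive c₂))) })))
            (λ d≡0 → run-assign⨾ (run-assign⨾ (run-assign (run-assign (record
              { row≡ = row₂
              ; count≡ = trans (cong (_+ 1) (trans c₂ (count≡ I))) (sym (trans (prefixSum-suc (bit ∘ twin G v) i)
                  (cong (λ b → prefixSum (bit ∘ twin G v) (toℕ i) + bit b) (≡⇒twin G (f d≡0)))))
              ; one = λ _ → i , ≤-refl , ≡⇒twin G (f d≡0) , trans (F₂ .regs rW refl) w≡
              ; two = λ le → let l , l< , tl , ll = one I (≤-trans (s≤s⁻¹ (≤-trans le (≤-reflexive (+-comm (reg σ₂ rCount) 1)))) (≤-reflexive c₂)) in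
                  record { p = l ; q = i ; p<q = l< ; q< = ≤-refl ; twin-p = tl ; twin-q = ≡⇒twin G (f d≡0)
                         ; prev≡ = trans last₂ ll ; last≡ = trans (F₂ .regs rW refl) w≡ } }))))))
        where
        R₁ : Rep σ₁ k A
        R₁ = rep-transport (F .regs rK refl) (F .regs rN refl) (F .mems refl) R

    record MajorityPair (σ : State) : Set where
      field
        p q      : Fin n
        p<q      : toℕ p < toℕ q
        rows     : ∀ j → a p j ≡ a q j
        majority : suc n < 2 * count (twin G q)
        p≡       : reg σ rP ≡ toℕ p
        q≡       : reg σ rQ ≡ toℕ q

    Found : ℕ → State → Set
    Found i σ = (reg σ rFound ≡ 0 × (∀ v → toℕ v < i → 2 * count (twin G v) ≤ suc n)) ⊎
                (reg σ rFound ≡ 1 × MajorityPair σ)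

    majorityPair-transport : ∀ {σ σ′} → reg σ′ rP ≡ reg σ rP → reg σ′ rQ ≡ reg σ rQ → MajorityPair σ → MajorityPair σ′
    majorityPair-transport P≡ Q≡ pr = record
      { p = p ; q = q ; p<q = p<q ; rows = rows ; majority = majority ; p≡ = trans P≡ p≡ ; q≡ = trans Q≡ q≡ }
      where open MajorityPair pr

    -- Being twins is an equivalence relation, so the class of `q` is as large as that of `v`.
    majorityPair : ∀ {v b σ σ′} → suc n < 2 * count (twin G v) → Twins< v b σ →
                   reg σ′ rP ≡ reg σ rPrev → reg σ′ rQ ≡ reg σ rLast → MajorityPair σ′
    majorityPair {v} maj t P≡ Q≡ = record
      { p        = p
      ; q        = q
      ; p<q      = p<q
      ; rows     = λ j → trans (sym (twin⇒≡ G twin-p j)) (twin⇒≡ G twin-q j)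
      ; majority = ≤-trans maj (*-monoʳ-≤ 2 (count-mono {p = twin G v} {q = twin G q}
                     λ w tw → ≡⇒twin G λ j → trans (sym (twin⇒≡ G twin-q j)) (twin⇒≡ G tw j)))
      ; p≡       = trans P≡ prev≡
      ; q≡       = trans Q≡ last≡ }
      where open Twins< t

    findMajority-spec : ∀ {σ} → Rep σ k A →
      Runs findMajority σ (λ σ′ → (reg σ′ rFound ≡ 0 × NoMajorityTwins G) ⊎ (reg σ′ rFound ≡ 1 × MajorityPair σ′))
    findMajority-spec {σ} R = run-assign⨾ (run-assign⨾ (run-weaken
        (λ σ′ _ (_ , found) → case found of λ where
          (inj₁ (f , none)) → inj₁ (f , λ v → none v (toℕ<n v))
          (inj₂ y)          → inj₂ y)
        (run-for Inv refl refl (Represents.order-reg R) n≤L (sym (*-zeroʳ n) , inj₁ (refl , λ _ ())) step)))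
      where
      Inv : ℕ → State → Set
      Inv i σ′ = reg σ′ rVRow ≡ n * i × Found i σ′
      σ₀ = setReg rVRow 0 (setReg rFound 0 σ)
      step : ∀ (i : Fin n) σ₁ → reg σ₁ rV ≡ toℕ i → Frame _ σ₀ σ₁ → Inv (toℕ i) σ₁ → Runs _ σ₁ _
      step i σ₁ v≡ F (row≡ , found) = run-then (countTwins-spec i R₁ row≡) λ σ₂ F₂ (c≡ , two) →
          let
            N₂ : reg σ₂ rN ≡ n
            N₂ = trans (F₂ .regs rN refl) (Represents.order-reg R₁)
            row₂ : reg σ₂ rVRow + reg σ₂ rN ≡ n * suc (toℕ i)
            row₂ = next-row n (trans (F₂ .regs rVRow refl) row≡) N₂
            2c≡ : reg σ₂ rCount + reg σ₂ rCount ≡ 2 * count (twin G i)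
            2c≡ = trans (cong₂ _+_ c≡ c≡) (cong (count (twin G i) +_) (sym (+-identityʳ _)))
            1+n≡ : reg σ₂ rN + 1 ≡ suc n
            1+n≡ = trans (cong (_+ 1) N₂) (+-comm n 1)
          in
          run-seq (run-cond
            (λ nz →
              let
                maj : suc n < 2 * count (twin G i)
                maj = ≰⇒> λ le → nz (m≤n⇒m∸n≡0 (subst₂ _≤_ (sym 2c≡) (sym 1+n≡) le))
              in
              run-assign⨾ (run-assign⨾ (run-assign (run-assign
                (row₂ , inj₂ (refl , majorityPair maj (two (subst (2 ≤_) (sym c≡) (≥2 i maj))) refl refl))))))
            (λ z → run-skip (run-assign (row₂ , (case found of λ where
              (inj₁ (f , none)) → inj₁ (trans (F₂ .regs rFound refl) f , λ v v<1+i → <-suc-cases v<1+i (none v)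
                 λ v≡i → subst (λ u → 2 * count (twin G u) ≤ suc n) (sym (toℕ-injective v≡i))
                     (subst₂ _≤_ 2c≡ 1+n≡ (m∸n≡0⇒m≤n z)))
              (inj₂ (f , pr)) → inj₂ (trans (F₂ .regs rFound refl) f ,
                majorityPair-transport (F₂ .regs rP refl) (F₂ .regs rQ refl) pr))))))
        where
        R₁ : Rep σ₁ k A
        R₁ = rep-transport (F .regs rK refl) (F .regs rN refl) (F .mems refl) R
        ≥2 : Fin n → ∀ {c} → suc n < 2 * c → 2 ≤ c
        -- The loop index witnesses n ≥ 1, so n + 1 < 2c forces c ≥ 2 and two twins have been
        -- recorded.
        ≥2 i {suc (suc c)} _ = s≤s (s≤s z≤n)
        ≥2 i {suc zero} lt = contradiction (≤-trans (s≤s (s≤s (≤-trans (s≤s z≤n) (toℕ<n i)))) lt) λ { (s≤s (s≤s ())) }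

  -- Deleting a vertex from the matrix in place

  module Deletion {m} (A : Adjacency (suc m)) (k : ℕ) (x : Fin (suc m)) (m≤L : m ≤ L) where

    private
      n = suc m
      a = A .adj
      a′ = minor x a

    -- d counts the entries written: cells below d form the new matrix, while the cells from d on
    -- are still those of the original state.
    record Compacted (d : ℕ) (σ₀ σ : State) : Set where
      field
        dst≡ : reg σ rDst ≡ d
        done : ∀ i j → m * toℕ i + toℕ j < d → mem σ (m * toℕ i + toℕ j) ≡ bit (a′ i j)
        rest : ∀ b → d ≤ b → mem σ b ≡ mem σ₀ b

    open Compacted

    source : Fin m → Fin m → ℕ
    source i j = n * toℕ (punchIn x i) + toℕ (punchIn x j)

    -- `punchIn` never lowers an index and the source has the longer rows, so an entry not yet
    -- copied cannot have been overwritten.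
    dst≤source : ∀ i j → m * toℕ i + toℕ j ≤ source i j
    dst≤source i j = +-mono-≤ (*-mono-≤ (n≤1+n m) (i≤ i)) (i≤ j)
      where
      i≤ : ∀ i → toℕ i ≤ toℕ (punchIn x i)
      i≤ i = ≤-trans (m≤m+n _ _) (≤-reflexive (sym (toℕ-punchIn x i)))

    address-injective : ∀ (i j i′ j′ : Fin m) → m * toℕ i + toℕ j ≡ m * toℕ i′ + toℕ j′ → i ≡ i′ × j ≡ j′
    address-injective i j i′ j′ eq = combine-injective i j i′ j′
      (toℕ-injective (trans (toℕ-combine i j) (trans eq (sym (toℕ-combine i′ j′)))))

    -- The source lies at or beyond the write position, where `rest` still gives the original entry.
    -- Cells already written are at other addresses, and a cell at the write position determines its
    -- row and column uniquely.
    copy-entry : ∀ {σ₀ σ} i j v → Rep σ₀ k A → Compacted (m * toℕ i + toℕ j) σ₀ σ → v ≡ mem σ (source i j) →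
                 ∀ {σ′} → reg σ′ rDst ≡ suc (m * toℕ i + toℕ j) → (∀ b → mem σ′ b ≡ update (mem σ) (reg σ rDst) v b) →
                 Compacted (m * toℕ i + suc (toℕ j)) σ₀ σ′
    copy-entry {σ₀} {σ} i j v R I v≡ {σ′} dst′ mem′ = record
      { dst≡ = trans dst′ (sym d≡)
      ; done = λ i′ j′ lt → trans (mem′ _) (<-suc-cases (≤-trans lt (≤-reflexive d≡))
          (λ lt′ → trans (update-other (mem σ) v (λ e → <⇒≢ lt′ (trans (sym e) (dst≡ I)))) (done I i′ j′ lt′))
          (λ e → let i≡ , j≡ = address-injective i′ j′ i j e in
            trans (cong (update (mem σ) (reg σ rDst) v) (trans e (sym (dst≡ I))))
              (trans (update-same (mem σ) (reg σ rDst) v)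
                (trans v≡ (trans (rest I (source i j) (dst≤source i j))
                  (trans (read R (punchIn x i) (punchIn x j) refl refl)
                      (cong₂ (λ u w → bit (a′ u w)) (sym i≡) (sym j≡))))))))
      ; rest = λ b le → let lt = ≤-trans (≤-reflexive (sym d≡)) le in
          trans (mem′ b) (trans (update-other (mem σ) v (λ e → <⇒≢ lt (trans (sym (dst≡ I)) e))) (rest I b (<⇒≤ lt))) }
      where
      d≡ : m * toℕ i + suc (toℕ j) ≡ suc (m * toℕ i + toℕ j)
      d≡ = +-suc (m * toℕ i) (toℕ j)

    compacted-cong : ∀ {d d′ σ₀ σ₀′ σ σ′} → d ≡ d′ → (∀ b → mem σ₀′ b ≡ mem σ₀ b) → reg σ′ rDst ≡ reg σ rDst →
        (∀ b → mem σ′ b ≡ mem σ b) →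
                     Compacted d σ₀ σ → Compacted d′ σ₀′ σ′
    compacted-cong refl mem₀ dst mem≡ I = record
      { dst≡ = trans dst (dst≡ I) ; done = λ i j lt → trans (mem≡ _) (done I i j lt)
      ; rest = λ b le → trans (mem≡ b) (trans (rest I b le) (sym (mem₀ b))) }

    deleteVertex-spec : ∀ {σ} → Rep σ k A → reg σ rX ≡ toℕ x → Runs deleteVertex σ (λ σ′ → Rep σ′ k (delete A x))
    deleteVertex-spec {σ} R x≡ = run-assign⨾ (run-assign⨾ (run-assign⨾ (run-then
        (run-for Inv refl refl (cong (_∸ 1) N≡) m≤L
          (sym (*-zeroʳ n) , record { dst≡ = sym (*-zeroʳ m) ; done = λ i j lt → contradiction
              (≤-trans lt (≤-reflexive (*-zeroʳ m))) λ () ; rest = λ _ _ → refl })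
          step)
        λ σ₁ F (_ , I) → run-assign (record
          { parameter-reg = trans (F .regs rK refl) (Represents.parameter-reg R)
          ; order-reg = trans (F .regs rM refl) (cong (_∸ 1) N≡)
          ; adj-mem = λ i j → trans (cong (mem σ₁) (toℕ-combine i j))
              (done I i j (subst (_< m * m) (toℕ-combine i j) (toℕ<n (combine i j)))) }))))
      where
      N≡ = Represents.order-reg R
      σ₀ = setReg rDst 0 (setReg rSrc 0 (setReg rM (reg σ rN ∸ 1) σ))
      Inv : ℕ → State → Set
      Inv i σ′ = reg σ′ rSrc ≡ n * i × Compacted (m * i) σ σ′
      step : ∀ (i : Fin m) σ₁ → reg σ₁ rI ≡ toℕ i → Frame _ σ₀ σ₁ → Inv (toℕ i) σ₁ → Runs _ σ₁ _
      step i σ₁ i≡ F (src≡ , I) = run-then row-spec λ σ₂ F₂ row≡ →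
          run-then
            (run-for (λ j σ′ → Compacted (m * toℕ i + j) σ σ′) refl refl (trans (F₂ .regs rM refl) M₁) m≤L
              (compacted-cong (sym (+-identityʳ _)) (λ _ → refl) (F₂ .regs rDst refl) (F₂ .mems refl) I)
              λ j σ₃ j≡ F₃ J →
                let
                  row₃ = trans (F₃ .regs rRow refl) row≡
                  x₃ = trans (F₃ .regs rX refl) (trans (F₂ .regs rX refl) x₁)
                in
                run-seq (run-store (run-assign
                  (copy-entry {σ} {σ₃} i j _ R J
                    (cong (mem σ₃) (cong₂ _+_ row₃ (trans (cong₂ (λ u w → u + (1 ∸ (w ∸ u))) j≡ x₃)
                        (sym (toℕ-punchIn x j)))))
                    (trans (+-comm _ 1) (cong suc (dst≡ J))) (λ _ → refl)))))
            λ σ₄ F₄ J → run-assign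
              ( next-row n (trans (F₄ .regs rSrc refl) (trans (F₂ .regs rSrc refl) src≡))
                           (trans (F₄ .regs rN refl) (trans (F₂ .regs rN refl) N₁))
              , compacted-cong (trans (+-comm (m * toℕ i) m) (sym (*-suc m (toℕ i)))) (λ _ → refl) refl (λ _ → refl) J )
        where
        M₁ : reg σ₁ rM ≡ m
        M₁ = trans (F .regs rM refl) (cong (_∸ 1) N≡)
        N₁ : reg σ₁ rN ≡ n
        N₁ = trans (F .regs rN refl) N≡
        x₁ : reg σ₁ rX ≡ toℕ x
        x₁ = trans (F .regs rX refl) x≡
        row-spec : Runs (cond (var rX ⊖ var rI) (rRow ≔ var rSrc) (rRow ≔ var rSrc ⊕ var rN)) σ₁
            (λ σ′ → reg σ′ rRow ≡ n * toℕ (punchIn x i))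
        row-spec = run-cond
          (λ nz → run-assign (trans src≡ (cong (n *_)
              (sym (trans (toℕ-punchIn x i) (trans
              (cong (toℕ i +_) (1∸-nonzero (subst₂ (λ u w → u ∸ w ≢ 0) x₁ i≡ nz))) (+-identityʳ _)))))))
          (λ z → run-assign (trans (next-row n src≡ N₁)
              (cong (n *_) (sym (trans (toℕ-punchIn x i)
              (trans (cong (λ v → toℕ i + (1 ∸ v)) (subst₂ (λ u w → u ∸ w ≡ 0) x₁ i≡ z)) (+-comm (toℕ i) 1)))))))
          where
          1∸-nonzero : ∀ {v} → v ≢ 0 → 1 ∸ v ≡ 0
          1∸-nonzero {zero}  v≢0 = contradiction refl v≢0
          1∸-nonzero {suc v} _   = 0∸n≡0 v

  ⇔-trans : ∀ {X Y Z : Set} → X ⇔ Y → Y ⇔ Z → X ⇔ Z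
  ⇔-trans f g = mk⇔ (Equivalence.to g ∘ Equivalence.to f) (Equivalence.from f ∘ Equivalence.from g)

  record Shrunk (n : ℕ) (A : Adjacency n) (k : ℕ) (σ : State) : Set where
    field
      {n′}  : ℕ
      n≡    : n ≡ 2 + n′
      A′    : Adjacency n′
      rep   : Rep σ k A′
      equiv : Yes (graph A) k ⇔ Yes (graph A′) k

  -- p < q rules out orders 0 and 1, and makes p keep its index when q is deleted, so `punchIn q p′`
  -- is p.
  deletePair-spec : ∀ {n} (A : Adjacency n) k (n≤L : n ≤ L) {σ} → Rep σ k A → Search.MajorityPair A k n≤L σ →
                    Runs deletePair σ (Shrunk n A k)
  deletePair-spec {zero} A k n≤L R record { p = () }
  deletePair-spec {suc zero} A k n≤L R record { p = zero ; q = zero ; p<q = () }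
  deletePair-spec {suc (suc n)} A k n≤L {σ} R
    record { p = p ; q = q ; p<q = p<q ; rows = rows ; majority = majority ; p≡ = p≡ ; q≡ = q≡ } =
    run-assign⨾ (run-then (Deletion.deleteVertex-spec A k q 1+n≤L (rep-transport refl refl (λ _ → refl) R) q≡) λ σ₁ F₁ R₁ →
    run-assign⨾ (run-weaken (λ σ₂ _ R₂ → record
        { n≡ = refl ; A′ = delete (delete A q) p′ ; rep = R₂
        ; equiv = TwinDeletion.delete-twins A q p′ (λ j → trans (cong (λ u → A .adj u j) p′≡) (rows j)) majority k })
      (Deletion.deleteVertex-spec (delete A q) k p′ (≤-trans (n≤1+n n) 1+n≤L) (rep-transport refl refl (λ _ → refl) R₁)
        (trans (F₁ .regs rP refl) (trans p≡ (sym (toℕ-fromℕ< p<1+n)))))))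
    where
    1+n≤L : suc n ≤ L
    1+n≤L = ≤-trans (n≤1+n (suc n)) n≤L
    p<1+n : toℕ p < suc n
    p<1+n = ≤-trans p<q (s≤s⁻¹ (toℕ<n q))
    p′ : Fin (suc n)
    p′ = fromℕ< p<1+n
    1∸-pos : ∀ {v} → 0 < v → 1 ∸ v ≡ 0
    1∸-pos {suc v} _ = 0∸n≡0 v
    p′≡ : punchIn q p′ ≡ p
    p′≡ = toℕ-injective (trans (toℕ-punchIn q p′) (trans (cong (λ v → v + (1 ∸ (toℕ q ∸ v))) (toℕ-fromℕ< p<1+n))
            (trans (cong (toℕ p +_) (1∸-pos (m<n⇒0<n∸m p<q))) (+-identityʳ (toℕ p)))))

  -- From exhaustive twin deletion to the kernel

  module Main {n₀} (A₀ : Adjacency n₀) (k : ℕ) where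

    record Reduced (σ : State) : Set where
      field
        {n}   : ℕ
        A     : Adjacency n
        n≤L   : n ≤ L
        rep   : Rep σ k A
        equiv : Yes (graph A₀) k ⇔ Yes (graph A) k

    reduce-spec : ∀ {σ} → suc n₀ ≤ L → Rep σ k A₀ →
      Runs reduce σ (λ σ′ → ∃[ r ] NoMajorityTwins (graph (Reduced.A {σ′} r)))
    reduce-spec {σ} n₀<L R = run-assign⨾ (run-weaken
        (λ σ′ _ (z , _ , I) → reduced I , stopped I z)
        (run-while Inv body n₀<L (record
          { reduced = record { A = A₀ ; n≤L = <⇒≤ n₀<L ; rep = rep-transport refl refl (λ _ → refl) R
                             ; equiv = mk⇔ id id }
          ; measure = ≤-reflexive (+-comm n₀ 1) ; stopped = λ () })))
      where
      -- A round either lowers n by two and leaves the flag at 1, or keeps n and clears the flag, so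
      -- n + `rFound` decreases. It starts at n₀ + 1.
      record Inv (m : ℕ) (σ : State) : Set where
        field
          reduced : Reduced σ
          measure : Reduced.n reduced + reg σ rFound ≤ m
          stopped : reg σ rFound ≡ 0 → NoMajorityTwins (graph (Reduced.A reduced))
      open Inv
      body : ∀ m σ → reg σ rFound ≢ 0 → Inv m σ → Runs _ σ (λ σ′ → ∃[ m′ ] m′ < m × Inv m′ σ′)
      body m σ f≢0 I = run-then (Search.findMajority-spec A k n≤L rep) λ σ₁ F₁ found →
          let
            R₁ = rep-transport (F₁ .regs rK refl) (F₁ .regs rN refl) (F₁ .mems refl) rep
          in
          run-cond
            (λ nz → case found of λ where
              (inj₁ (f , _))  → contradiction f nz
              (inj₂ (f , pr)) → run-weaken (λ σ₂ F₂ S → let open Shrunk S using (n′; n≡; A′) in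
                  suc n′ , ≤-trans (≤-reflexive (sym n≡)) (≤-trans (m≤m+n _ _) (measure I)) , record
                    { reduced = record { A = A′ ; n≤L = ≤-trans (m≤n+m n′ 2) (≤-trans (≤-reflexive (sym n≡)) n≤L)
                                       ; rep = Shrunk.rep S ; equiv = ⇔-trans equiv (Shrunk.equiv S) }
                    ; measure = ≤-reflexive (trans (cong (n′ +_) (trans (F₂ .regs rFound refl) f)) (+-comm n′ 1))
                    ; stopped = λ z → contradiction (trans (sym z) (trans (F₂ .regs rFound refl) f)) λ () })
                (deletePair-spec A k n≤L R₁ pr))
            (λ z → case found of λ where
              (inj₁ (f , none)) → run-skip (n , <-≤-trans
                  (≤-trans (≤-reflexive (+-comm 1 n)) (+-monoʳ-≤ n (n≢0⇒n>0 f≢0))) (measure I) , record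
                { reduced = record { A = A ; n≤L = n≤L ; rep = R₁ ; equiv = equiv }
                ; measure = ≤-reflexive (trans (cong (n +_) f) (+-identityʳ n)) ; stopped = λ _ → none })
              (inj₂ (f , _)) → contradiction (trans (sym z) f) λ ())
        where open Reduced (reduced I)

    module Checks {n} (A : Adjacency n) (n≤L : n ≤ L) where

      -- s = k · min(k , i), split according to whether the loop is still adding.
      Square : ℕ → ℕ → Set
      Square i s = (i ≤ k × s ≡ k * i) ⊎ (k ≤ i × s ≡ k * k)

      squareParameter-spec : ∀ {σ} → Rep σ k A → Runs squareParameter σ (λ σ′ → Square n (reg σ′ rSq))
      squareParameter-spec R = run-assign⨾ (run-for (λ i σ′ → Square i (reg σ′ rSq)) refl refl (Represents.order-reg R) n≤L
        (inj₁ (z≤n , sym (*-zeroʳ k)))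
        λ i σ₁ i≡ F I →
          let
            K₁ : reg σ₁ rK ≡ k
            K₁ = trans (F .regs rK refl) (Represents.parameter-reg R)
          in
          run-cond
            (λ nz → let i<k = ≰⇒> λ k≤i → nz (trans (cong₂ _∸_ K₁ i≡) (m≤n⇒m∸n≡0 k≤i)) in
              run-assign (case I of λ where
                (inj₁ (_ , s≡))   → inj₁ (i<k , next-row k s≡ K₁)
                (inj₂ (k≤i , _)) → contradiction k≤i (<⇒≱ i<k)))
            (λ z → let k≤i = m∸n≡0⇒m≤n (trans (sym (cong₂ _∸_ K₁ i≡)) z) in
              run-skip (case I of λ where
                (inj₁ (i≤k , s≡)) → inj₂ (m≤n⇒m≤1+n k≤i , trans s≡ (cong (k *_) (≤-antisym i≤k k≤i)))
                (inj₂ (_ , s≡))   → inj₂ (m≤n⇒m≤1+n k≤i , s≡))))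

      scaleParameter-spec : ∀ {σ} → Rep σ k A → Runs scaleParameter σ (λ σ′ → reg σ′ rKN ≡ k * n)
      scaleParameter-spec R = run-assign⨾ (run-for (λ i σ′ → reg σ′ rKN ≡ k * i) refl refl (Represents.order-reg R) n≤L
        (sym (*-zeroʳ k))
        λ i σ₁ i≡ F I → run-assign (next-row k I (trans (F .regs rK refl) (Represents.parameter-reg R))))

      sumMatrix-spec : ∀ {σ} → Rep σ k A → Runs sumMatrix σ (λ σ′ → reg σ′ rSum ≡ vol (graph A))
      sumMatrix-spec {σ} R = run-assign⨾ (run-assign⨾ (run-weaken (λ σ′ _ (_ , s≡) → trans s≡ (prefixSum-full rowSum))
          (run-for Inv refl refl (Represents.order-reg R) n≤L (sym (*-zeroʳ n) , sym (prefixSum-zero rowSum)) step)))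
        where
        rowSum : Fin n → ℕ
        rowSum i = count (A .adj i)
        Inv : ℕ → State → Set
        Inv i σ′ = reg σ′ rRow ≡ n * i × reg σ′ rSum ≡ prefixSum rowSum i
        σ₀ = setReg rRow 0 (setReg rSum 0 σ)
        step : ∀ (i : Fin n) σ₁ → reg σ₁ rI ≡ toℕ i → Frame _ σ₀ σ₁ → Inv (toℕ i) σ₁ → Runs _ σ₁ _
        step i σ₁ i≡ F (row≡ , s≡) = run-then
            (run-for (λ j σ′ → reg σ′ rSum ≡ prefixSum rowSum (toℕ i) + prefixSum (bit ∘ A .adj i) j) refl refl N₁ n≤L
              (trans s≡ (sym (trans (cong (prefixSum rowSum (toℕ i) +_) (prefixSum-zero (bit ∘ A .adj i))) (+-identityʳ _))))
              λ j σ₂ j≡ F₂ J → run-assign (trans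
                (cong₂ _+_ J (read (rep-transport {σ′ = σ₂} (F₂ .regs rK refl) (F₂ .regs rN refl)
                    (F₂ .mems refl) R₁) i j (trans (F₂ .regs rRow refl) row≡) j≡))
                (trans (+-assoc (prefixSum rowSum (toℕ i)) _ _)
                    (cong (prefixSum rowSum (toℕ i) +_) (sym (prefixSum-suc (bit ∘ A .adj i) j))))))
            λ σ₃ F₃ J → run-assign
              ( next-row n (trans (F₃ .regs rRow refl) row≡) (trans (F₃ .regs rN refl) N₁)
              , trans J (trans (cong (prefixSum rowSum (toℕ i) +_) (prefixSum-full (bit ∘ A .adj i)))
                  (sym (prefixSum-suc rowSum i))) )
          where
          R₁ : Rep σ₁ k A
          R₁ = rep-transport (F .regs rK refl) (F .regs rN refl) (F .mems refl) R
          N₁ : reg σ₁ rN ≡ n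
          N₁ = Represents.order-reg R₁

      square⇒≤ : ∀ {s} → Square n s → s ≤ k * k
      square⇒≤ (inj₁ (n≤k , s≡)) = ≤-trans (≤-reflexive s≡) (*-monoʳ-≤ k n≤k)
      square⇒≤ (inj₂ (_ , s≡))   = ≤-reflexive s≡

      -- Using min(k , n) in place of k weakens nothing: if n ≤ k then n ≤ k·n, and the tested bound
      -- holds by itself.
      square⇒order≤ : ∀ {s} → Square n s → n ≤ 32 * (k * k) + 1 → n ≤ 32 * s + 1
      square⇒order≤ (inj₂ (_ , refl)) n≤ = n≤
      square⇒order≤ (inj₁ (n≤k , refl)) _ = ≤-trans (below n≤k) (≤-trans (m≤n*m (k * n) 32) (m≤m+n _ 1))
        where
        below : ∀ {n k} → n ≤ k → n ≤ k * n
        below {zero}  _ = z≤n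
        below {suc n} {suc k} _ = m≤m+n (suc n) (k * suc n)

      yesGraph : Adjacency 0
      yesGraph = record { adj = λ () ; sym-adj = λ () ; irrefl = λ () }

      yesGraph-yes : Yes (graph yesGraph) 0
      yesGraph-yes = (λ ()) , record { lower = z≤n ; upper = z≤n } , z≤n

      edges≤ : n ≤ 32 * (k * k) + 1 → vol (graph A) ≤ 8 * (k * n) → ∣E∣ (graph A) ≤ 132 * (k ^ 3 + 1)
      edges≤ n≤ vol≤ = ≤-trans (*-cancelˡ-≤ 2 (begin
          2 * ∣E∣ (graph A)                   ≡⟨ vol≡2∣E∣ (graph A) ⟩
          vol (graph A)                       ≤⟨ vol≤ ⟩
          8 * (k * n)                         ≤⟨ *-monoʳ-≤ 8 (*-monoʳ-≤ k n≤) ⟩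
          8 * (k * (32 * (k * k) + 1))        ≡⟨ ring₁ k ⟩
          2 * (128 * k ^ 3 + 4 * k)           ≤⟨ *-monoʳ-≤ 2 (+-monoʳ-≤ (128 * k ^ 3) (*-monoʳ-≤ 4 (k≤k³ k))) ⟩
          2 * (128 * k ^ 3 + 4 * k ^ 3)       ≡⟨ cong (2 *_) (*-distribʳ-+ (k ^ 3) 128 4) ⟨
          2 * (132 * k ^ 3)                   ∎)) (*-monoʳ-≤ 132 (m≤m+n (k ^ 3) 1))
        where
        open ≤-Reasoning
        ring₁ : ∀ k → 8 * (k * (32 * (k * k) + 1)) ≡ 2 * (128 * (k * (k * (k * 1))) + 4 * k)
        ring₁ = solve-∀
        k≤k³ : ∀ k → k ≤ k ^ 3
        k≤k³ zero = z≤n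
        k≤k³ k@(suc _) = ≤-trans (≤-reflexive (sym (*-identityʳ k))) (^-monoʳ-≤ k {1} {3} (s≤s z≤n))

      order≤ : n ≤ 32 * (k * k) + 1 → n ≤ 132 * (k ^ 2 + 1)
      order≤ n≤ = ≤-trans n≤ (begin
        32 * (k * k) + 1             ≤⟨ +-mono-≤ (*-monoˡ-≤ (k * k) (m≤m+n 32 100)) (s≤s z≤n) ⟩
        132 * (k * k) + 132          ≡⟨ ring₁ k ⟩
        132 * (k ^ 2 + 1)            ∎)
        where
        open ≤-Reasoning
        ring₁ : ∀ k → 132 * (k * k) + 132 ≡ 132 * (k * (k * 1) + 1)
        ring₁ = solve-∀

      -- A nonzero test violates one of the bounds of `cuttable-or-small`, which leaves only a
      -- yes-instance, equivalent to the empty graph with parameter 0. A zero test bounds the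
      -- reduced graph itself, which is kept with parameter k.
      answerIfLarge-spec : ∀ {σ} → Rep σ k A → Yes (graph A₀) k ⇔ Yes (graph A) k → NoMajorityTwins (graph A) →
        Square n (reg σ rSq) → reg σ rKN ≡ k * n → reg σ rSum ≡ vol (graph A) →
        Runs answerIfLarge σ (λ σ′ → ∃[ I ] Represents σ′ I × IsKernel (graph A₀) k I)
      answerIfLarge-spec {σ} R equiv noMaj sq kn≡ sum≡ = run-cond
          (λ nz → run-assign⨾ (run-assign
            ( (graph yesGraph ,, 0)
            , record { parameter-reg = refl ; order-reg = refl ; adj-mem = λ () }
            , record { equiv = mk⇔ (λ _ → yesGraph-yes) (λ _ → Equivalence.from equiv (large⇒yes nz))
                     ; k′≤k = z≤n ; V≤ = z≤n ; E≤ = z≤n })))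
          (λ z → run-skip (_ , R , record
            { equiv = equiv ; k′≤k = ≤-refl ; V≤ = order≤ (n≤ z) ; E≤ = edges≤ (n≤ z) (vol≤ z) }))
        where
        s = reg σ rSq
        N = reg σ rN
        test = ⟦ (var rN ⊖ (double (double (double (double (double (var rSq))))) ⊕ const 1)) ⊕
                 (var rSum ⊖ double (double (double (var rKN)))) ⟧ σ
        dbl : ℕ → ℕ
        dbl v = v + v
        ×8 : ∀ v → dbl (dbl (dbl v)) ≡ 8 * v
        ×8 = ring
          where
          ring : ∀ v → v + v + (v + v) + (v + v + (v + v)) ≡ 8 * v
          ring = solve-∀
        ×32 : ∀ v → dbl (dbl (dbl (dbl (dbl v)))) ≡ 32 * v
        ×32 v = trans (cong (dbl ∘ dbl) (×8 v)) (ring v)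
          where
          ring : ∀ v → 8 * v + 8 * v + (8 * v + 8 * v) ≡ 32 * v
          ring = solve-∀
        test≡ : test ≡ (n ∸ (32 * s + 1)) + (vol (graph A) ∸ 8 * (k * n))
        test≡ = cong₂ _+_ (cong₂ _∸_ (Represents.order-reg R) (cong (_+ 1) (×32 s)))
                          (cong₂ _∸_ sum≡ (trans (×8 (reg σ rKN)) (cong (8 *_) kn≡)))
        n≤ : test ≡ 0 → n ≤ 32 * (k * k) + 1
        n≤ z = ≤-trans (m∸n≡0⇒m≤n (m+n≡0⇒m≡0 _ (trans (sym test≡) z))) (+-monoˡ-≤ 1 (*-monoʳ-≤ 32 (square⇒≤ sq)))
        vol≤ : test ≡ 0 → vol (graph A) ≤ 8 * (k * n)
        vol≤ z = m∸n≡0⇒m≤n (m+n≡0⇒n≡0 (n ∸ (32 * s + 1)) (trans (sym test≡) z))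
        large⇒yes : test ≢ 0 → Yes (graph A) k
        large⇒yes nz = case Completion.cuttable-or-small (graph A) k noMaj of λ where
          (inj₁ y) → y
          (inj₂ (n≤′ , vol≤′)) → contradiction
              (trans test≡ (cong₂ _+_ (m≤n⇒m∸n≡0 (square⇒order≤ sq n≤′)) (m≤n⇒m∸n≡0 vol≤′))) nz

    kernelize-spec : ∀ {σ} → suc n₀ ≤ L → Rep σ k A₀ → Runs kernelize σ
        (λ σ′ → ∃[ I ] Represents σ′ I × IsKernel (graph A₀) k I)
    kernelize-spec n₀<L R = run-then (reduce-spec n₀<L R) λ σ₁ _ (r , noMaj) →
      let
        open Reduced r
        open Checks A n≤L
      in
      run-then (squareParameter-spec rep) λ σ₂ F₂ sq →
      let R₂ = rep-transport (F₂ .regs rK refl) (F₂ .regs rN refl) (F₂ .mems refl) rep in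
      run-then (scaleParameter-spec R₂) λ σ₃ F₃ kn≡ →
      let R₃ = rep-transport (F₃ .regs rK refl) (F₃ .regs rN refl) (F₃ .mems refl) R₂ in
      run-then (sumMatrix-spec R₃) λ σ₄ F₄ sum≡ →
      let R₄ = rep-transport (F₄ .regs rK refl) (F₄ .regs rN refl) (F₄ .mems refl) R₃ in
      answerIfLarge-spec R₄ equiv noMaj
        (subst (Square n) (sym (trans (F₄ .regs rSq refl) (F₃ .regs rSq refl))) sq)
        (trans (F₄ .regs rKN refl) kn≡) sum≡

-- The kernel is read off the total-correctness proof of the program.  That proof is
-- kept abstract, since unfolding the run during type checking is infeasible.
abstract

  runKernelize : ∀ G k → Hoare.Runs (suc ∥ G ,, k ∥) kernelize (input (G ,, k))
      (λ σ → ∃[ J ] Represents σ J × IsKernel G k J)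
  runKernelize G k = Correctness.Main.kernelize-spec (suc ∥ G ,, k ∥) (fromGraph G) k
      -- The input length contains n², so L = 1 + length is at least n + 1, the initial measure of
      -- `reduce`.
      (s≤s (≤-trans (n≤n² (∣V∣ G)) (m≤m+n _ _))) (input-represents (G ,, k))
    where
    n≤n² : ∀ n → n ≤ n * n
    n≤n² zero    = z≤n
    n≤n² (suc n) = m≤m*n (suc n) (suc n)

kernel : Instance → Instance
kernel (G ,, k) = proj₁ (Hoare.post (runKernelize G k))

kernel-isKernel : ∀ G k → IsKernel G k (kernel (G ,, k))
kernel-isKernel G k = proj₂ (proj₂ (Hoare.post (runKernelize G k)))

kernelize-computes-kernel : kernelize ComputesInPolyTime kernel
kernelize-computes-kernel = coefficient , degree , λ (G ,, k) →
    _ , _ , Hoare.evals (runKernelize G k)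
    , ≤-trans (Hoare.timely (runKernelize G k)) (bounded ∥ G ,, k ∥)
    , proj₁ (proj₂ (Hoare.post (runKernelize G k)))
  where open PolyBounded (time-poly kernelize)

mainTheorem1 :
    ∃[ P ] ∃[ kernel ] ∃[ c ]
      P ComputesInPolyTime kernel ×
      c > 0 ×
      ((G : Graph) (k : ℕ) →
        let G′ = Instance.graph (kernel (G ,, k))
            k′ = Instance.parameter (kernel (G ,, k))
        in
        (HasBisection≥ G (⌈ ∣E∣ G /2⌉ + k) ⇔ HasBisection≥ G′ (⌈ ∣E∣ G′ /2⌉ + k′)) ×
        k′ ≤ k ×
        ∣V∣ G′ ≤ c * (k ^ 2 + 1) ×
        ∣E∣ G′ ≤ c * (k ^ 3 + 1))
mainTheorem1 = kernelize , kernel , 132 , kernelize-computes-kernel , s≤s z≤n , λ G k →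
  let open IsKernel (kernel-isKernel G k) in
  mk⇔ (cuttable⇒hasBisection ∘ Equivalence.to equiv ∘ hasBisection⇒cuttable)
      (cuttable⇒hasBisection ∘ Equivalence.from equiv ∘ hasBisection⇒cuttable)
  , k′≤k , V≤ , E≤
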